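{- Let $d,n$ be positive integers with $d\le n$. Then $\mathcal{C}_d$ is $d$-cube-free, and every $d$-cube-free subset of $\mathbb{Z}_{2^n}$ which is a union of some layers $L_i$ has size at most $|\mathcal{C}_d|$.
   Context: $\mathbb{Z}_{2^n}$ is the cyclic group of integers modulo $2^n$. For $1\le i\le n$ the $i$-th layer is $L_i=\{x\in\mathbb{Z}_{2^n}: x\equiv 2^{i-1} \pmod{2^i}\}$, and $L_{n+1}=\{0\}$. For a multiset $S=\{a_1,\dots,a_d\}$ of $d$ not necessarily distinct elements of $\mathbb{Z}_{2^n}$, let $\Sigma^*S=\{\sum_{i\in I}a_i \bmod 2^n : \emptyset\neq I\subseteq\{1,\dots,d\}\}$ (a set), the projective $d$-cube generated by $S$. A set $A\subseteq\mathbb{Z}_{2^n}$ is $d$-cube-free if there is no multiset $S$ of size $d$ with $\Sigma^*S\subseteq A$. Define index sets $I_d\subseteq\mathbb{Z}_{>0}$ recursively: $I_1=\emptyset$; for $d\ge 2$, let $\ell$ be the largest integer with $2^\ell\le d$ and set $I_d=\{1,2,\dots,\ell\}\cup\{j+\ell+1: j\in I_{d-2^\ell+1}\}$. Then $\mathcal{C}_d=\bigcup_{i\in I_d}L_i$ (when $d\le n$ all indices in $I_d$ are at most $n$). For example $\mathcal{C}_3=L_1\cup L_3$ and $\mathcal{C}_{26}=L_1\cup L_2\cup L_3\cup L_4\cup L_6\cup L_7\cup L_8\cup L_{10}\cup L_{11}$. -}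

module Defs where

open import Data.Nat using (ℕ; zero; suc; _+_; _∸_; _^_; _%_; _≡ᵇ_; _<ᵇ_; _≤ᵇ_; NonZero)
open import Data.Nat.Properties using (m^n≢0)
open import Data.Nat.DivMod using (_mod_)
open import Data.Nat.Logarithm using (⌊log₂_⌋)
open import Data.Bool using (Bool; true; false; _∧_; _∨_; if_then_else_)
open import Data.Fin using (Fin; toℕ)
open import Data.Fin.Subset using (Subset; _∈_; Nonempty; ⋃)
open import Data.Vec using (Vec; tabulate; lookup)
open import Data.List using (List; []; _∷_; _++_; map; upTo)
open import Data.Product using (∃)
open import Relation.Nullary using (¬_)

inLayerᵇ : (n i x : ℕ) → Bool
inLayerᵇ n i x =
  ((1 ≤ᵇ i) ∧ (i ≤ᵇ n) ∧ ((_%_ x (2 ^ i) {{m^n≢0 2 i}}) ≡ᵇ (2 ^ (i ∸ 1))))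
  ∨ ((i ≡ᵇ suc n) ∧ (x ≡ᵇ 0))

Layer : (n i : ℕ) → Subset (2 ^ n)
Layer n i = tabulate (λ x → inLayerᵇ n i (toℕ x))

LayerUnion : (n : ℕ) → List ℕ → Subset (2 ^ n)
LayerUnion n J = ⋃ (map (Layer n) J)

-- Index sets I_d, computed with fuel.  For d ≥ 2 the recursive call is on
-- d - 2^ℓ + 1 < d, so fuel d suffices (see indexSet below).
indexSetFuel : ℕ → ℕ → List ℕ
indexSetFuel zero    d = []
indexSetFuel (suc f) d with d <ᵇ 2
... | true  = []
... | false =
  let ℓ = ⌊log₂ d ⌋ in
  map suc (upTo ℓ) ++ map (λ j → j + ℓ + 1) (indexSetFuel f ((d ∸ 2 ^ ℓ) + 1))

indexSet : ℕ → List ℕ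
indexSet d = indexSetFuel d d

𝒞 : (n d : ℕ) → Subset (2 ^ n)
𝒞 n d = LayerUnion n (indexSet d)

subsetSumℕ : ∀ {m d} → Vec (Fin m) d → Subset d → ℕ
subsetSumℕ {d = zero}  _       _            = 0
subsetSumℕ {d = suc d} (a Vec.∷ as) (b Vec.∷ bs) =
  (if b then toℕ a else 0) + subsetSumℕ as bs

subsetSum : ∀ n {d} → Vec (Fin (2 ^ n)) d → Subset d → Fin (2 ^ n)
subsetSum n a I = _mod_ (subsetSumℕ a I) (2 ^ n) {{m^n≢0 2 n}}

CubeIn : ∀ n {d} → Vec (Fin (2 ^ n)) d → Subset (2 ^ n) → Set
CubeIn n {d} a A = (I : Subset d) → Nonempty I → subsetSum n a I ∈ A

CubeFree : (n d : ℕ) → Subset (2 ^ n) → Set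
CubeFree n d A = ¬ ∃ (λ (a : Vec (Fin (2 ^ n)) d) → CubeIn n a A)

{-# OPTIONS --safe #-}
-- A union of layers is ordered in size by the lexicographic order of its index set, so it
-- suffices to show that C_d is cube-free and that adding to C_d a layer k ∉ I_d, while keeping
-- only the layers of C_d before k, creates a d-cube.  Let N = 2^ℓ ≤ d < 2N and M = 2N.
--
-- Cube-freeness: no subset sum of a cube S in C_d is ≡ N mod M.  Loop-erase the walk with steps S
-- in ℤ/M: this splits S into loops T₁, …, T_g and a simple path.  The vertex sets of the loops
-- and of the path have a sumset in which no two elements differ by N, because differences of
-- vertices of T_i are again subset sums of T_i.  Such a sumset obeys the bound
-- |A + B| ≥ |A| + |B| - 1 (Dyson's e-transform: stability under a nonzero translation forces
-- stability under translation by N), and it has at most N elements, whence g ≥ d - N + 1.  The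
-- sums of the loops are multiples of M and form a cube in M·C_{d-N+1}.
--
-- Cube construction: from a cube b₁, …, b_{d-N+1} for the layer k - ℓ - 1 take
-- M b₂, …, M b_{d-N+1} together with N - 1 ones and M b₁ - (N - 1); if k = ℓ + 1, take d ones.
module Submission where

open import Defs
open import Data.Bool using (T)
open import Data.Bool.Properties using (T-≡; T-∧; T-∨)
open import Data.Empty using (⊥; ⊥-elim)
open import Data.Fin as Fin using (Fin; toℕ)
import Data.Fin.Properties as Finₚ
open import Data.Fin.Subset as Subset using (Subset; Nonempty; ∣_∣; inside; outside; _-_)
open import Data.Fin.Subset.Properties
  using (∉⊥; x∈p∪q⁻; x∈p∪q⁺; x∈p∧x≢y⇒x∈p-y; x∈p⇒∣p-x∣<∣p∣; p⊆q⇒∣p∣≤∣q∣)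
open import Data.List
  using (List; []; _∷_; _++_; map; length; concat; filter; lookup; replicate; upTo)
open import Data.List.Membership.Propositional using (_∈_; find; lose)
open import Data.List.Membership.Propositional.Properties
  using (∈-map⁻; ∈-map⁺; ∈-++⁻; ∈-++⁺ˡ; ∈-++⁺ʳ; ∈-filter⁻; ∈-lookup; ∈-upTo⁺; ∈-upTo⁻)
open import Data.List.Properties
  using (length-map; length-++; length-filter; length-replicate; filter-reject; ++-assoc)
open import Data.List.Relation.Binary.Permutation.Propositional as Perm using (_↭_; ↭-sym; ↭-trans; prep)
open import Data.List.Relation.Binary.Permutation.Propositional.Properties
  using (shift; ++-comm; ++⁺ʳ; ↭-length)
open import Data.List.Relation.Unary.All as All using (All; []; _∷_)
import Data.List.Relation.Unary.All.Properties as Allₚ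
open import Data.List.Relation.Unary.AllPairs as AllPairs using (AllPairs; []; _∷_)
import Data.List.Relation.Unary.AllPairs.Properties as AllPairsₚ
open import Data.List.Relation.Unary.Any using (Any; here; there; any?)
open import Data.Nat
open import Data.Nat.DivMod
open import Data.Nat.Divisibility
open import Data.Nat.Induction using (<-wellFounded)
open import Data.Nat.ListAction using (sum)
open import Data.Nat.Logarithm using (⌊log₂_⌋)
open import Data.Nat.Logarithm.Core using (⌊log2⌋)
open import Data.Nat.Properties
open import Data.Nat.Tactic.RingSolver using (solve-∀)
open import Data.List.Membership.DecPropositional _≟_ using (_∈?_)
open import Data.Product using (∃; ∃₂; _×_; _,_; proj₁; proj₂)
open import Data.Sum using (_⊎_; inj₁; inj₂)
open import Data.Vec as Vec using (Vec; []; _∷_)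
open import Data.Vec.Properties using (lookup∘tabulate; lookup⇒[]=; []=⇒lookup; length-toList)
open import Function using (_∘_)
open import Function.Bundles using (Equivalence)
open import Induction.WellFounded using (Acc; acc)
open import Relation.Binary.Definitions using (tri<; tri≈; tri>)
open import Relation.Binary.PropositionalEquality
open import Relation.Nullary using (¬_; Dec; yes; no; ¬?; contradiction)
open import Relation.Nullary.Decidable using (map′)

-- 2-adic valuations

-- The odd part is carried as data in the form `suc (2 * half)`, so 0 has no valuation at all.
record Val (v s : ℕ) : Set where
  constructor val
  field
    half     : ℕ
    equation : s ≡ 2 ^ v * suc (2 * half)

halve : ∀ s → ∃ λ q → s ≡ 2 * q ⊎ s ≡ suc (2 * q)
halve zero = 0 , inj₁ refl
halve (suc s) with halve s
... | q , inj₁ eq = q , inj₂ (cong suc eq)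
... | q , inj₂ eq = suc q , inj₁ (trans (cong suc eq) (lem q))
  where
  lem : ∀ q → suc (suc (2 * q)) ≡ 2 * suc q
  lem = solve-∀

2∤odd : ∀ q → ¬ 2 ∣ suc (2 * q)
2∤odd q 2∣ = contradiction (∣1⇒≡1 (∣m+n∣m⇒∣n (subst (2 ∣_) (+-comm 1 (2 * q)) 2∣) (m∣m*n q))) λ ()

2^-mono-∣ : ∀ {m n} → m ≤ n → 2 ^ m ∣ 2 ^ n
2^-mono-∣ {m} {n} m≤n = divides (2 ^ (n ∸ m))
  (trans (cong (2 ^_) (sym (m∸n+n≡m m≤n))) (^-distribˡ-+-* 2 (n ∸ m) m))

Val⇒∣ : ∀ {v m s} → Val v s → m ≤ v → 2 ^ m ∣ s
Val⇒∣ (val q refl) m≤v = ∣m⇒∣m*n (suc (2 * q)) (2^-mono-∣ m≤v)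

Val⇒∤ : ∀ {v m s} → Val v s → v < m → ¬ 2 ^ m ∣ s
Val⇒∤ {v} (val q refl) v<m d =
  2∤odd q (*-cancelˡ-∣ (2 ^ v) {{m^n≢0 2 v}}
    (subst (_∣ 2 ^ v * suc (2 * q)) (*-comm 2 (2 ^ v)) (∣-trans (2^-mono-∣ v<m) d)))

Val-unique : ∀ {v w s} → Val v s → Val w s → v ≡ w
Val-unique {v} {w} p q with <-cmp v w
... | tri< v<w _ _ = contradiction (Val⇒∣ q v<w) (Val⇒∤ p ≤-refl)
... | tri≈ _ v≡w _ = v≡w
... | tri> _ _ w<v = contradiction (Val⇒∣ p w<v) (Val⇒∤ q ≤-refl)

-- Repeated halving meets an odd number before `m` rounds are over; non-divisibility excludes
-- `s = 0`, which could be halved forever.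
∤⇒Val : ∀ m s → ¬ 2 ^ m ∣ s → ∃ λ v → v < m × Val v s
∤⇒Val zero s ¬d = contradiction (1∣ s) ¬d
∤⇒Val (suc m) s ¬d with halve s
... | q , inj₂ refl = 0 , s≤s z≤n , val q (sym (*-identityˡ (suc (2 * q))))
... | q , inj₁ refl with ∤⇒Val m q (λ d → ¬d (*-monoʳ-∣ 2 d))
... | v , v<m , val r eq =
  suc v , s≤s v<m , val r (trans (cong (2 *_) eq) (sym (*-assoc 2 (2 ^ v) (suc (2 * r)))))

Val-scale : ∀ m {v s} → Val v s → Val (m + v) (2 ^ m * s)
Val-scale m {v} (val q refl) = val q (trans (sym (*-assoc (2 ^ m) (2 ^ v) _))
  (cong (_* suc (2 * q)) (sym (^-distribˡ-+-* 2 m v))))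

Val-unscale : ∀ m {v s} → Val (m + v) (2 ^ m * s) → Val v s
Val-unscale m {v} {s} (val q eq) = val q (*-cancelˡ-≡ s _ (2 ^ m) {{m^n≢0 2 m}}
  (trans eq (trans (cong (_* suc (2 * q)) (^-distribˡ-+-* 2 m v)) (*-assoc (2 ^ m) (2 ^ v) _))))

Val⇒>0 : ∀ {v s} → Val v s → 0 < s
Val⇒>0 {v} (val q refl) = *-mono-< {0} {2 ^ v} {0} (m^n>0 2 v) (s≤s z≤n)

-- Subset sums

-- Sums stay in ℕ, unreduced, so that a power of two can be divided out exactly; residues modulo
-- `2 ^ n` return only in `Residues`.
data Σ₀ : List ℕ → ℕ → Set where
  nil  : Σ₀ [] 0
  skip : ∀ {a S s} → Σ₀ S s → Σ₀ (a ∷ S) s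
  take : ∀ {a S s} → Σ₀ S s → Σ₀ (a ∷ S) (a + s)

-- `here` marks the first chosen element, after which the selection is unrestricted.
data Σ⁺ : List ℕ → ℕ → Set where
  here  : ∀ {a S s} → Σ₀ S s → Σ⁺ (a ∷ S) (a + s)
  there : ∀ {a S s} → Σ⁺ S s → Σ⁺ (a ∷ S) s

Σ₀⇒≡0⊎Σ⁺ : ∀ {S s} → Σ₀ S s → s ≡ 0 ⊎ Σ⁺ S s
Σ₀⇒≡0⊎Σ⁺ nil = inj₁ refl
Σ₀⇒≡0⊎Σ⁺ (skip p) with Σ₀⇒≡0⊎Σ⁺ p
... | inj₁ e = inj₁ e
... | inj₂ q = inj₂ (there q)
Σ₀⇒≡0⊎Σ⁺ (take p) = inj₂ (here p)

Σ₀-0 : ∀ S → Σ₀ S 0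
Σ₀-0 []      = nil
Σ₀-0 (a ∷ S) = skip (Σ₀-0 S)

Σ₀-sum : ∀ S → Σ₀ S (sum S)
Σ₀-sum []      = nil
Σ₀-sum (a ∷ S) = take (Σ₀-sum S)

Σ₀-++ : ∀ {S T s t} → Σ₀ S s → Σ₀ T t → Σ₀ (S ++ T) (s + t)
Σ₀-++ nil q = q
Σ₀-++ (skip p) q = skip (Σ₀-++ p q)
Σ₀-++ {T = T} {t = t} (take {a} {S} {s} p) q =
  subst (Σ₀ (a ∷ S ++ T)) (sym (+-assoc a s t)) (take (Σ₀-++ p q))

Σ⁺-++ˡ : ∀ {S T s t} → Σ⁺ S s → Σ₀ T t → Σ⁺ (S ++ T) (s + t)
Σ⁺-++ˡ {T = T} {t = t} (here {a} {S} {s} p) q =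
  subst (Σ⁺ (a ∷ S ++ T)) (sym (+-assoc a s t)) (here (Σ₀-++ p q))
Σ⁺-++ˡ (there p) q = there (Σ⁺-++ˡ p q)

Σ⁺-++ʳ : ∀ S {T t} → Σ⁺ T t → Σ⁺ (S ++ T) t
Σ⁺-++ʳ []      p = p
Σ⁺-++ʳ (a ∷ S) p = there (Σ⁺-++ʳ S p)

Σ₀-swap : ∀ {a b S T s} → (∀ {s} → Σ₀ S s → Σ₀ T s) → Σ₀ (a ∷ b ∷ S) s → Σ₀ (b ∷ a ∷ T) s
Σ₀-swap f (skip (skip p)) = skip (skip (f p))
Σ₀-swap f (skip (take p)) = take (skip (f p))
Σ₀-swap f (take (skip p)) = skip (take (f p))
Σ₀-swap {a} {b} {T = T} f (take (take {s = s} p)) =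
  subst (Σ₀ (b ∷ a ∷ T)) (+-lem b a s) (take (take (f p)))
  where
  +-lem : ∀ b a s → b + (a + s) ≡ a + (b + s)
  +-lem = solve-∀

Σ₀-↭ : ∀ {S T s} → S ↭ T → Σ₀ S s → Σ₀ T s
Σ₀-↭ Perm.refl p = p
Σ₀-↭ (Perm.prep x r) (skip p) = skip (Σ₀-↭ r p)
Σ₀-↭ (Perm.prep x r) (take p) = take (Σ₀-↭ r p)
Σ₀-↭ (Perm.swap x y r) p = Σ₀-swap (Σ₀-↭ r) p
Σ₀-↭ (Perm.trans r r′) p = Σ₀-↭ r′ (Σ₀-↭ r p)

Σ⁺-↭ : ∀ {S T s} → S ↭ T → Σ⁺ S s → Σ⁺ T s
Σ⁺-↭ Perm.refl p = p
Σ⁺-↭ (Perm.prep x r) (here p)  = here (Σ₀-↭ r p)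
Σ⁺-↭ (Perm.prep x r) (there p) = there (Σ⁺-↭ r p)
Σ⁺-↭ (Perm.swap x y r) (here (skip p)) = there (here (Σ₀-↭ r p))
Σ⁺-↭ {T = _ ∷ _ ∷ T} (Perm.swap x y r) (here (take {s = s} p)) =
  subst (Σ⁺ (y ∷ x ∷ T)) (lem y x s) (here (take (Σ₀-↭ r p)))
  where
  lem : ∀ y x s → y + (x + s) ≡ x + (y + s)
  lem = solve-∀
Σ⁺-↭ (Perm.swap x y r) (there (here p))  = here (skip (Σ₀-↭ r p))
Σ⁺-↭ (Perm.swap x y r) (there (there p)) = there (there (Σ⁺-↭ r p))
Σ⁺-↭ (Perm.trans r r′) p = Σ⁺-↭ r′ (Σ⁺-↭ r p)

-- Supplies negatives: when the total is 0 modulo `M`, the unchosen elements sum to minus the chosen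
-- ones.
Σ₀-complement : ∀ {S s} → Σ₀ S s → ∃ λ t → Σ₀ S t × s + t ≡ sum S
Σ₀-complement nil = 0 , nil , refl
Σ₀-complement (skip {a} {S} {s} p) with Σ₀-complement p
... | t , q , eq = a + t , take q , trans (lem s a t) (cong (a +_) eq)
  where
  lem : ∀ s a t → s + (a + t) ≡ a + (s + t)
  lem = solve-∀
Σ₀-complement (take {a} {S} {s} p) with Σ₀-complement p
... | t , q , eq = t , skip q , trans (+-assoc a s t) (cong (a +_) eq)

-- Congruences

module Congruence (M : ℕ) .{{_ : NonZero M}} where

  infix 4 _≈_
  record _≈_ (x y : ℕ) : Set where
    constructor %≡
    field %≡⁻ : x % M ≡ y % M
  open _≈_ public

  _≈?_ : ∀ x y → Dec (x ≈ y)
  x ≈? y = map′ %≡ %≡⁻ (x % M ≟ y % M)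

  ≈-refl : ∀ {x} → x ≈ x
  ≈-refl = %≡ refl

  ≈-reflexive : ∀ {x y} → x ≡ y → x ≈ y
  ≈-reflexive refl = ≈-refl

  ≈-sym : ∀ {x y} → x ≈ y → y ≈ x
  ≈-sym (%≡ p) = %≡ (sym p)

  ≈-trans : ∀ {x y z} → x ≈ y → y ≈ z → x ≈ z
  ≈-trans (%≡ p) (%≡ q) = %≡ (trans p q)

  +-cong-≈ : ∀ {x x′ y y′} → x ≈ x′ → y ≈ y′ → x + y ≈ x′ + y′
  +-cong-≈ {x} {x′} {y} {y′} (%≡ p) (%≡ q) = %≡ (begin
    (x + y) % M              ≡⟨ %-distribˡ-+ x y M ⟩
    (x % M + y % M) % M      ≡⟨ cong₂ (λ u v → (u + v) % M) p q ⟩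
    (x′ % M + y′ % M) % M    ≡⟨ %-distribˡ-+ x′ y′ M ⟨
    (x′ + y′) % M            ∎)
    where open ≡-Reasoning

  +kM≈ : ∀ x k → x + k * M ≈ x
  +kM≈ x k = %≡ ([m+kn]%n≡m%n x k M)

  ∣⇒≈0 : ∀ {x} → M ∣ x → x ≈ 0
  ∣⇒≈0 (divides k refl) = +kM≈ 0 k

  ≈0⇒∣ : ∀ {x} → x ≈ 0 → M ∣ x
  ≈0⇒∣ {x} (%≡ p) = m%n≡0⇒n∣m x M (trans p (m*n%n≡0 0 M))

  -- `a * pred M` plays the role of `-a`: together with `a` it makes a multiple of `M`.
  +-cancelˡ-≈ : ∀ a {x y} → a + x ≈ a + y → x ≈ y
  +-cancelˡ-≈ a {x} {y} p = ≈-trans (≈-sym (shift≈ x)) (≈-trans (+-cong-≈ (≈-refl {a * pred M}) p) (shift≈ y))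
    where
    lem : ∀ a k z → a * k + (a + z) ≡ z + a * suc k
    lem = solve-∀
    shift≈ : ∀ z → a * pred M + (a + z) ≈ z
    shift≈ z =
      ≈-trans (≈-reflexive (trans (lem a (pred M) z) (cong (λ m → z + a * m) (suc-pred M)))) (+kM≈ z a)

-- Loop erasure and the Dyson e-transform

-- These are the vertices of the walk from 0 with steps `S`. The start is split off because `absorb`
-- keeps 0 in its second summand throughout.
partials steps : List ℕ → List ℕ
partials S = 0 ∷ steps S
steps []      = []
steps (a ∷ S) = map (a +_) (partials S)

length-partials : ∀ S → length (partials S) ≡ suc (length S)
length-partials []      = refl
length-partials (a ∷ S) = cong suc (trans (length-map (a +_) (partials S)) (length-partials S))

∈-partials⇒Σ₀ : ∀ S {p} → p ∈ partials S → Σ₀ S p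
∈-partials⇒Σ₀ S (here refl) = Σ₀-0 S
∈-partials⇒Σ₀ (a ∷ S) (there p∈) with ∈-map⁻ (a +_) p∈
... | q , q∈ , refl = take (∈-partials⇒Σ₀ S q∈)

-- The steps walked between two vertices add up to their difference; the order of the two vertices
-- decides the sign.
partials-diff : ∀ S {p q} → p ∈ partials S → q ∈ partials S →
  ∃ λ s → Σ₀ S s × (p ≡ q + s ⊎ q ≡ p + s)
partials-diff S {q = q} (here refl) q∈ = q , ∈-partials⇒Σ₀ S q∈ , inj₂ refl
partials-diff S {p = p} p∈@(there _) (here refl) = p , ∈-partials⇒Σ₀ S p∈ , inj₁ refl
partials-diff (a ∷ S) (there p∈) (there q∈) with ∈-map⁻ (a +_) p∈ | ∈-map⁻ (a +_) q∈
... | p , p∈′ , refl | q , q∈′ , refl with partials-diff S p∈′ q∈′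
... | s , σ , inj₁ refl = s , skip σ , inj₁ (sym (+-assoc a q s))
... | s , σ , inj₂ refl = s , skip σ , inj₂ (sym (+-assoc a p s))

∈-partials-split : ∀ S {p} → p ∈ partials S → ∃₂ λ R₁ R₂ → S ≡ R₁ ++ R₂ × p ≡ sum R₁
∈-partials-split S (here refl) = [] , S , refl , refl
∈-partials-split (a ∷ S) (there p∈) with ∈-map⁻ (a +_) p∈
... | q , q∈ , refl with ∈-partials-split S q∈
... | R₁ , R₂ , refl , refl = a ∷ R₁ , R₂ , refl , refl

module Walk (M : ℕ) .{{_ : NonZero M}} where
  open Congruence M

  Distinct : List ℕ → Set
  Distinct = AllPairs (λ x y → ¬ x ≈ y)

  Distinct-shift⁺ : ∀ a {xs} → Distinct xs → Distinct (map (a +_) xs)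
  Distinct-shift⁺ a D = AllPairsₚ.map⁺ (AllPairs.map (λ x≉y → x≉y ∘ +-cancelˡ-≈ a) D)

  Distinct-shift⁻ : ∀ a {xs} → Distinct (map (a +_) xs) → Distinct xs
  Distinct-shift⁻ a D = AllPairs.map (λ x≉y → x≉y ∘ +-cong-≈ ≈-refl) (AllPairsₚ.map⁻ D)

  Path : List ℕ → Set
  Path S = Distinct (partials S)

  All-partials-++ˡ : ∀ {P : ℕ → Set} S {T} → All P (partials (S ++ T)) → All P (partials S)
  All-partials-++ˡ []      (p ∷ _)  = p ∷ []
  All-partials-++ˡ (a ∷ S) (p ∷ ps) = p ∷ Allₚ.map⁺ (All-partials-++ˡ S (Allₚ.map⁻ ps))

  Path-++ˡ : ∀ S {T} → Path (S ++ T) → Path S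
  Path-++ˡ []      _        = [] ∷ []
  Path-++ˡ (a ∷ S) (z ∷ zs) =
    Allₚ.map⁺ (All-partials-++ˡ S (Allₚ.map⁻ z)) ∷ Distinct-shift⁺ a (Path-++ˡ S (Distinct-shift⁻ a zs))

  Path-++ʳ : ∀ S {T} → Path (S ++ T) → Path T
  Path-++ʳ []      p        = p
  Path-++ʳ (a ∷ S) (_ ∷ zs) = Path-++ʳ S (Distinct-shift⁻ a zs)

  -- The closed walk is read from the end of its first step: `S` visits `length S + 1` distinct
  -- vertices, and `a` leads from the last back to the first.
  data Loop : List ℕ → Set where
    loop : ∀ {a S} → Path S → a + sum S ≈ 0 → Loop (a ∷ S)

  -- The new step goes in front, so the old path is shifted by `a`. If it then meets the new start 0
  -- at `a + p`, the steps up to `p` together with `a` are split off as a loop, and the remaining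
  -- steps are still a path.
  loopErase : ∀ S → ∃₂ λ loops R → S ↭ concat loops ++ R × All Loop loops × Path R
  loopErase [] = [] , [] , Perm.refl , [] , [] ∷ []
  loopErase (a ∷ S) with loopErase S
  ... | Ls , R , S↭ , loops , path with any? (λ p → (a + p) ≈? 0) (partials R)
  ... | no none =
    Ls , a ∷ R , ↭-trans (prep a S↭) (↭-sym (shift a (concat Ls) R)) , loops ,
    Allₚ.map⁺ (All.map (_∘ ≈-sym) (Allₚ.¬Any⇒All¬ (partials R) none)) ∷ Distinct-shift⁺ a path
  ... | yes some with find some
  ... | p , p∈ , a+p≈0 with ∈-partials-split R p∈
  ... | R₁ , R₂ , refl , refl =
    (a ∷ R₁) ∷ Ls , R₂ , prep a S↭′ , loop (Path-++ˡ R₁ path) a+p≈0 ∷ loops , Path-++ʳ R₁ path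
    where
    S↭′ : S ↭ (R₁ ++ concat Ls) ++ R₂
    S↭′ = ↭-trans S↭ (subst (_↭ (R₁ ++ concat Ls) ++ R₂) (++-assoc (concat Ls) R₁ R₂)
            (++⁺ʳ R₂ (++-comm (concat Ls) R₁)))

  -- Of the two arcs between vertices of a loop, one has the required sign: the direct arc, or the
  -- complementary one through `a`. Hence, unlike in `partials-diff`, the direction can be chosen.
  loop-diff : ∀ a S {p q} → a + sum S ≈ 0 → p ∈ partials S → q ∈ partials S →
    ∃ λ s → Σ₀ (a ∷ S) s × p ≈ q + s
  loop-diff a S closed p∈ q∈ with partials-diff S p∈ q∈
  ... | s , σ , inj₁ refl = s , skip σ , ≈-refl
  loop-diff a S {p} closed p∈ q∈ | s , σ , inj₂ refl with Σ₀-complement σ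
  ... | t , τ , s+t≡ = a + t , take τ , ≈-sym (≈-trans (≈-reflexive eq)
                        (≈-trans (+-cong-≈ (≈-refl {p}) closed) (≈-reflexive (+-identityʳ p))))
    where
    lem : ∀ p s a t → (p + s) + (a + t) ≡ p + (a + (s + t))
    lem = solve-∀
    eq : (p + s) + (a + t) ≡ p + (a + sum S)
    eq = trans (lem p s a t) (cong (λ u → p + (a + u)) s+t≡)

  module _ (h : ℕ) (multiple : ∀ {b} → ¬ b ≈ 0 → ∃ λ k → k * b ≈ h) where

    length-filter-split : ∀ {P : ℕ → Set} (P? : ∀ x → Dec (P x)) xs →
      length (filter (¬? ∘ P?) xs) + length (filter P? xs) ≡ length xs
    length-filter-split P? [] = refl
    length-filter-split P? (x ∷ xs) with P? x
    ... | yes _ = trans (+-suc _ _) (cong suc (length-filter-split P? xs))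
    ... | no  _ = cong suc (length-filter-split P? xs)

    -- The bound |A + B| ≥ |A| + |B| - 1 with `0 ∷ B` as second summand; `X` stands for the sumset
    -- closed under congruence. By `multiple`, every nonzero `b` generates `h`. The number `k`
    -- bounds the recursion, since the e-transform replaces `B` by a filtered list.
    absorb : ∀ {X : ℕ → Set} → (∀ {x y} → x ≈ y → X x → X y) → (∀ {x y} → X x → X y → ¬ x ≈ y + h) →
      ∀ k A B → length B ≤ k → 0 < length A → Distinct A → Distinct (0 ∷ B) →
      (∀ {a b} → a ∈ A → b ∈ 0 ∷ B → X (a + b)) →
      ∃ λ C → Distinct C × All X C × length C ≡ length A + length B
    absorb {X} X-resp no-h k A [] _ _ DA _ A+B⊆X =
      A , DA , All.tabulate (λ {a} a∈ → subst X (+-identityʳ a) (A+B⊆X a∈ (here refl))) , sym (+-identityʳ _)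
    absorb {X} X-resp no-h (suc k) A@(x ∷ _) (b ∷ B) (s≤s B≤k) 0<A DA DB@(0∉B ∷ DB′) A+B⊆X
      with any? (λ e → ¬? (any? (λ a → (e + b) ≈? a) A)) A
    -- Here A + b lies in A, so the orbit of `x` under `b` stays in `A` and reaches x + h, although
    -- `X` has no two elements that differ by `h`.
    ... | no stable = ⊥-elim (no-h Xa Xx (≈-trans (≈-sym x+jb≈a) (+-cong-≈ (≈-refl {x}) jb≈h)))
      where
      b≉0 : ¬ b ≈ 0
      b≉0 = All.head 0∉B ∘ ≈-sym
      +b-stable : ∀ {e} → e ∈ A → ∃ λ a → a ∈ A × e + b ≈ a
      +b-stable {e} e∈ with any? (λ a → (e + b) ≈? a) A
      ... | yes some = find some
      ... | no none  = ⊥-elim (stable (lose e∈ none))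
      orbit : ∀ j → ∃ λ a → a ∈ A × x + j * b ≈ a
      orbit zero    = x , here refl , ≈-reflexive (+-identityʳ x)
      orbit (suc j) with orbit j
      ... | a , a∈ , eq with +b-stable a∈
      ... | a′ , a′∈ , eq′ = a′ , a′∈ ,
        ≈-trans (≈-reflexive (lem x b (j * b))) (≈-trans (+-cong-≈ eq (≈-refl {b})) eq′)
        where
        lem : ∀ x b c → x + (b + c) ≡ (x + c) + b
        lem = solve-∀
      j : ℕ
      j = proj₁ (multiple b≉0)
      jb≈h : j * b ≈ h
      jb≈h = proj₂ (multiple b≉0)
      Xx : X x
      Xx = subst X (+-identityʳ x) (A+B⊆X (here refl) (here refl))
      Xa : X (proj₁ (orbit j))
      Xa = subst X (+-identityʳ _) (A+B⊆X (proj₁ (proj₂ (orbit j))) (here refl))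
      x+jb≈a : x + j * b ≈ proj₁ (orbit j)
      x+jb≈a = proj₂ (proj₂ (orbit j))
    -- The Dyson e-transform: points of e + B outside A are moved to A.
    ... | yes escape = enlarge (find escape)
      where
      enlarge : (∃ λ e → e ∈ A × ¬ Any (e + b ≈_) A) → _
      enlarge (e , e∈ , e+b∉A) = C , DC , C⊆X , |C|
        where
        in? : ∀ c → Dec (Any (e + c ≈_) A)
        in? c = any? (λ a → (e + c) ≈? a) A
        B₁ B₂ A′ : List ℕ
        B₁ = filter in? (b ∷ B)
        B₂ = filter (¬? ∘ in?) (b ∷ B)
        A′ = A ++ map (e +_) B₂
        -- `b` is among the points moved, because e + b is outside `A`; this makes `B₁` shorter than
        -- `b ∷ B`.
        |B₁|≤k : length B₁ ≤ k
        |B₁|≤k = ≤-trans (≤-reflexive (cong length (filter-reject in? {b} {B} e+b∉A)))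
          (≤-trans (length-filter in? B) B≤k)
        |A′| : length A′ ≡ length A + length B₂
        |A′| = trans (length-++ A) (cong (length A +_) (length-map (e +_) B₂))
        disjoint : All (λ a → All (λ c → ¬ a ≈ c) (map (e +_) B₂)) A
        disjoint = All.tabulate λ {a} a∈ → Allₚ.map⁺
          (All.map (λ c∉ a≈ → c∉ (lose a∈ (≈-sym a≈))) (Allₚ.all-filter (¬? ∘ in?) (b ∷ B)))
        DA′ : Distinct A′
        DA′ = AllPairsₚ.++⁺ DA (Distinct-shift⁺ e (AllPairsₚ.filter⁺ (¬? ∘ in?) DB′)) disjoint
        DB₁ : Distinct (0 ∷ B₁)
        DB₁ = Allₚ.filter⁺ in? 0∉B ∷ AllPairsₚ.filter⁺ in? DB′
        B₁-in : ∀ {c} → c ∈ 0 ∷ B₁ → c ∈ 0 ∷ b ∷ B × Any (e + c ≈_) A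
        -- 0 always stays in the second summand, because e + 0 lies in `A`.
        B₁-in (here refl) = here refl , lose e∈ (≈-reflexive (+-identityʳ e))
        B₁-in (there c∈) with ∈-filter⁻ in? {xs = b ∷ B} c∈
        ... | c∈B , p = there c∈B , p
        A′+B₁⊆X : ∀ {a c} → a ∈ A′ → c ∈ 0 ∷ B₁ → X (a + c)
        A′+B₁⊆X {a} {c} a∈ c∈ with B₁-in c∈ | ∈-++⁻ A a∈
        ... | c∈B , _  | inj₁ a∈A = A+B⊆X a∈A c∈B
        -- For a moved point e + c′ and a kept c, exchange the roles: (e + c′) + c = (e + c) + c′,
        -- and e + c is congruent to a point of `A`.
        ... | _ , e+c∈ | inj₂ a∈m with ∈-map⁻ (e +_) a∈m | find e+c∈
        ... | c′ , c′∈ , refl | a′ , a′∈ , e+c≈a′ =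
          X-resp (≈-trans (+-cong-≈ (≈-sym e+c≈a′) (≈-refl {c′})) (≈-reflexive (lem e c c′)))
                 (A+B⊆X a′∈ (there (proj₁ (∈-filter⁻ (¬? ∘ in?) {xs = b ∷ B} c′∈))))
          where
          lem : ∀ e c c′ → (e + c) + c′ ≡ (e + c′) + c
          lem = solve-∀
        rec : ∃ λ C → Distinct C × All X C × length C ≡ length A′ + length B₁
        rec = absorb X-resp no-h k A′ B₁ |B₁|≤k (s≤s z≤n) DA′ DB₁ A′+B₁⊆X
        C : List ℕ
        C = proj₁ rec
        DC : Distinct C
        DC = proj₁ (proj₂ rec)
        C⊆X : All X C
        C⊆X = proj₁ (proj₂ (proj₂ rec))
        |C| : length C ≡ length A + length (b ∷ B)
        |C| = begin
          length C                               ≡⟨ proj₂ (proj₂ (proj₂ rec)) ⟩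
          length A′ + length B₁                  ≡⟨ cong (_+ length B₁) |A′| ⟩
          length A + length B₂ + length B₁       ≡⟨ +-assoc (length A) _ _ ⟩
          length A + (length B₂ + length B₁)     ≡⟨ cong (length A +_) (length-filter-split in? (b ∷ B)) ⟩
          length A + length (b ∷ B)              ∎
          where open ≡-Reasoning

-- Walks modulo 2N that avoid N

module HalfModulus (ℓ : ℕ) where
  N M : ℕ
  N = 2 ^ ℓ
  M = 2 ^ suc ℓ
  instance
    N≢0 : NonZero N
    N≢0 = m^n≢0 2 ℓ
    M≢0 : NonZero M
    M≢0 = m^n≢0 2 (suc ℓ)

  open Congruence M
  open Walk M

  Val⇒≈N : ∀ {s} → Val ℓ s → s ≈ N
  Val⇒≈N (val q refl) = ≈-trans (≈-reflexive (lem N q)) (+kM≈ N q)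
    where
    lem : ∀ n q → n * suc (2 * q) ≡ n + q * (2 * n)
    lem = solve-∀

  ≈N⇒Val : ∀ {s} → s ≈ N → Val ℓ s
  ≈N⇒Val {s} (%≡ eq) = val (s / M) (begin
    s                       ≡⟨ m≡m%n+[m/n]*n s M ⟩
    s % M + (s / M) * M     ≡⟨ cong (_+ (s / M) * M) (trans eq (m<n⇒m%n≡m N<M)) ⟩
    N + (s / M) * M         ≡⟨ lem N (s / M) ⟩
    N * suc (2 * (s / M))   ∎)
    where
    open ≡-Reasoning
    N<M : N < M
    N<M = ^-monoʳ-< 2 (s≤s (s≤s z≤n)) (n<1+n ℓ)
    lem : ∀ n q → n + q * (2 * n) ≡ n * suc (2 * q)
    lem = solve-∀

  N+N≈0 : N + N ≈ 0
  N+N≈0 = ∣⇒≈0 (divides 1 (lem N))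
    where
    lem : ∀ n → n + n ≡ 1 * (2 * n)
    lem = solve-∀

  -- A nonzero residue has valuation v ≤ ℓ, and the factor 2^(ℓ-v) raises it to exactly ℓ. This is
  -- the hypothesis `multiple` with `h = N`.
  multiple≈N : ∀ {b} → ¬ b ≈ 0 → ∃ λ k → k * b ≈ N
  multiple≈N {b} b≉0 with ∤⇒Val (suc ℓ) b (b≉0 ∘ ∣⇒≈0)
  ... | v , s≤s v≤ℓ , b-val =
    2 ^ (ℓ ∸ v) , Val⇒≈N (subst (λ w → Val w (2 ^ (ℓ ∸ v) * b)) (m∸n+n≡m v≤ℓ) (Val-scale (ℓ ∸ v) b-val))

  ≈residue : ∀ x → x ≈ x % N ⊎ x ≈ x % N + N
  ≈residue x with halve (x / N)
  ... | q , inj₁ even = inj₁ (≈-trans (≈-reflexive eq) (+kM≈ (x % N) q))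
    where
    lem : ∀ r q n → r + (2 * q) * n ≡ r + q * (2 * n)
    lem = solve-∀
    eq : x ≡ x % N + q * M
    eq = trans (m≡m%n+[m/n]*n x N) (trans (cong (λ c → x % N + c * N) even) (lem (x % N) q N))
  ... | q , inj₂ odd = inj₂ (≈-trans (≈-reflexive eq) (+kM≈ (x % N + N) q))
    where
    lem : ∀ r q n → r + suc (2 * q) * n ≡ r + n + q * (2 * n)
    lem = solve-∀
    eq : x ≡ x % N + N + q * M
    eq = trans (m≡m%n+[m/n]*n x N) (trans (cong (λ c → x % N + c * N) odd) (lem (x % N) q N))

  -- N is its own negative modulo `M`.
  ≈+N-sym : ∀ {x y} → x ≈ y + N → y ≈ x + N
  ≈+N-sym {x} {y} x≈y+N = ≈-sym (≈-trans (+-cong-≈ x≈y+N ≈-refl) (≈-trans (≈-reflexive (+-assoc y N N))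
    (≈-trans (+-cong-≈ (≈-refl {y}) N+N≈0) (≈-reflexive (+-identityʳ y)))))

  %N≡⇒≈ : ∀ x y → x % N ≡ y % N → x ≈ y ⊎ x ≈ y + N
  %N≡⇒≈ x y eq with y % N | eq | ≈residue x | ≈residue y
  ... | _ | refl | inj₁ x≈ | inj₁ y≈ = inj₁ (≈-trans x≈ (≈-sym y≈))
  ... | _ | refl | inj₁ x≈ | inj₂ y≈ = inj₂ (≈+N-sym (≈-trans y≈ (+-cong-≈ (≈-sym x≈) ≈-refl)))
  ... | _ | refl | inj₂ x≈ | inj₁ y≈ = inj₂ (≈-trans x≈ (+-cong-≈ (≈-sym y≈) ≈-refl))
  ... | _ | refl | inj₂ x≈ | inj₂ y≈ = inj₁ (≈-trans x≈ (≈-sym y≈))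

  Difference : List ℕ → ℕ → ℕ → Set
  Difference S x y = ∃ λ s → Σ₀ S s × (x ≈ y + s ⊎ y ≈ x + s)

  AvoidsN : List ℕ → Set
  AvoidsN S = ∀ {s} → Σ₀ S s → ¬ s ≈ N

  Difference≉N : ∀ {S x y} → AvoidsN S → Difference S x y → ¬ x ≈ y + N
  Difference≉N {y = y} avoids (s , σ , inj₁ x≈y+s) x≈y+N =
    avoids σ (+-cancelˡ-≈ y (≈-trans (≈-sym x≈y+s) x≈y+N))
  Difference≉N {x = x} avoids (s , σ , inj₂ y≈x+s) x≈y+N =
    avoids σ (+-cancelˡ-≈ x (≈-trans (≈-sym y≈x+s) (≈+N-sym x≈y+N)))

  -- A path with r steps has r + 1 vertices, and by `absorb` a loop with m steps, hence m vertices,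
  -- enlarges the set by m - 1. So `C` has one element more than the number of steps, less one for
  -- each loop.
  foldLoops : ∀ {loops} R → All Loop loops → Path R → AvoidsN (concat loops ++ R) →
    ∃ λ C → 0 < length C × Distinct C × (∀ {x y} → x ∈ C → y ∈ C → Difference (concat loops ++ R) x y)
      × length C + length loops ≡ suc (length (concat loops ++ R))
  foldLoops R [] path avoids = partials R , s≤s z≤n , path , diff , trans (+-identityʳ _) (length-partials R)
    where
    diff : ∀ {x y} → x ∈ partials R → y ∈ partials R → Difference R x y
    diff x∈ y∈ with partials-diff R x∈ y∈
    ... | s , σ , inj₁ eq = s , σ , inj₁ (≈-reflexive eq)
    ... | s , σ , inj₂ eq = s , σ , inj₂ (≈-reflexive eq)
  foldLoops {(a ∷ S) ∷ loops} R (loop pathS closed ∷ ls) path avoids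
    with foldLoops R ls path (λ σ → avoids (subst (λ T → Σ₀ (a ∷ T) _) (sym (++-assoc S (concat loops) R))
                                             (Σ₀-++ (Σ₀-0 (a ∷ S)) σ)))
  ... | A , 0<A , DA , diffA , |A| = C , 0<C , DC , diffC , |C|
    where
    U : List ℕ
    U = concat loops ++ R
    assoc : (a ∷ S) ++ U ≡ concat ((a ∷ S) ∷ loops) ++ R
    assoc = cong (a ∷_) (sym (++-assoc S (concat loops) R))
    X : ℕ → Set
    X z = ∃₂ λ c p → c ∈ A × p ∈ partials S × z ≈ c + p
    -- The sign of the difference inside `A` is given, but a loop offers both signs, so `loop-diff`
    -- is applied in the matching direction and the two sums concatenate.
    X-diff : ∀ {x y} → X x → X y → Difference (concat ((a ∷ S) ∷ loops) ++ R) x y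
    X-diff {x} {y} (c , p , c∈ , p∈ , x≈) (d , q , d∈ , q∈ , y≈) with diffA c∈ d∈
    ... | s , σ , inj₁ c≈d+s with loop-diff a S closed p∈ q∈
    ... | t , τ , p≈q+t = t + s , subst (λ T → Σ₀ T (t + s)) assoc (Σ₀-++ τ σ) , inj₁
          (≈-trans x≈ (≈-trans (+-cong-≈ c≈d+s p≈q+t)
          (≈-trans (≈-reflexive (lem d s q t)) (+-cong-≈ (≈-sym y≈) ≈-refl))))
      where
      lem : ∀ d s q t → (d + s) + (q + t) ≡ (d + q) + (t + s)
      lem = solve-∀
    X-diff {x} {y} (c , p , c∈ , p∈ , x≈) (d , q , d∈ , q∈ , y≈)
      | s , σ , inj₂ d≈c+s with loop-diff a S closed q∈ p∈
    ... | t , τ , q≈p+t = t + s , subst (λ T → Σ₀ T (t + s)) assoc (Σ₀-++ τ σ) , inj₂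
          (≈-trans y≈ (≈-trans (+-cong-≈ d≈c+s q≈p+t)
          (≈-trans (≈-reflexive (lem c s p t)) (+-cong-≈ (≈-sym x≈) ≈-refl))))
      where
      lem : ∀ d s q t → (d + s) + (q + t) ≡ (d + q) + (t + s)
      lem = solve-∀
    absorbed : ∃ λ C → Distinct C × All X C × length C ≡ length A + length (steps S)
    absorbed = absorb N multiple≈N
      (λ { x≈y (c , p , c∈ , p∈ , x≈) → c , p , c∈ , p∈ , ≈-trans (≈-sym x≈y) x≈ })
      (λ Xx Xy → Difference≉N avoids (X-diff Xx Xy))
      (length (steps S)) A (steps S) ≤-refl 0<A DA pathS
      (λ c∈ p∈ → _ , _ , c∈ , p∈ , ≈-refl)
    C : List ℕ
    C = proj₁ absorbed
    DC : Distinct C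
    DC = proj₁ (proj₂ absorbed)
    diffC : ∀ {x y} → x ∈ C → y ∈ C → Difference (concat ((a ∷ S) ∷ loops) ++ R) x y
    diffC x∈ y∈ = X-diff (All.lookup C⊆X x∈) (All.lookup C⊆X y∈)
      where C⊆X = proj₁ (proj₂ (proj₂ absorbed))
    |C|≡ : length C ≡ length A + length S
    |C|≡ = trans (proj₂ (proj₂ (proj₂ absorbed))) (cong (length A +_) (suc-injective (length-partials S)))
    0<C : 0 < length C
    0<C = ≤-trans 0<A (≤-trans (m≤m+n (length A) (length S)) (≤-reflexive (sym |C|≡)))
    |C| : length C + suc (length loops) ≡ suc (length (concat ((a ∷ S) ∷ loops) ++ R))
    |C| = begin
      length C + suc (length loops)                  ≡⟨ cong (_+ suc (length loops)) |C|≡ ⟩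
      length A + length S + suc (length loops)       ≡⟨ lem (length A) (length S) (length loops) ⟩
      suc (length S + (length A + length loops))     ≡⟨ cong (λ n → suc (length S + n)) |A| ⟩
      suc (length S + suc (length U))                ≡⟨ cong suc (+-suc (length S) (length U)) ⟩
      suc (suc (length S + length U))                ≡⟨ cong (λ n → suc (suc n)) (length-++ S) ⟨
      suc (length ((a ∷ S) ++ U))                    ≡⟨ cong (suc ∘ length) assoc ⟩
      suc (length (concat ((a ∷ S) ∷ loops) ++ R))   ∎
      where
      open ≡-Reasoning
      lem : ∀ a s l → a + s + suc l ≡ suc (s + (a + l))
      lem = solve-∀

  lookup-distinct : ∀ {xs} → Distinct xs → ∀ {i j} → i Fin.< j → ¬ lookup xs i ≈ lookup xs j
  lookup-distinct (x∉ ∷ D) {Fin.zero}  {Fin.suc j} _         = All.lookup x∉ (∈-lookup j)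
  lookup-distinct (x∉ ∷ D) {Fin.suc i} {Fin.suc j} (s≤s i<j) = lookup-distinct D i<j

  -- Among more than `N` elements two agree modulo `N`, so modulo `M = 2N` they are congruent or
  -- differ by `N`.
  length≤N : ∀ {C} → Distinct C → (∀ {x y} → x ∈ C → y ∈ C → ¬ x ≈ y + N) → length C ≤ N
  length≤N {C} DC avoids = ≮⇒≥ λ N<|C| → collide (Finₚ.pigeonhole N<|C| (λ i → lookup C i mod N))
    where
    toℕ-mod : ∀ x → toℕ (x mod N) ≡ x % N
    toℕ-mod x = Finₚ.toℕ-fromℕ< (m%n<n x N)
    collide : (∃₂ λ i j → i Fin.< j × lookup C i mod N ≡ lookup C j mod N) → ⊥
    collide (i , j , i<j , eq) with %N≡⇒≈ (lookup C i) (lookup C j)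
      (trans (sym (toℕ-mod (lookup C i))) (trans (cong toℕ eq) (toℕ-mod (lookup C j))))
    ... | inj₁ x≈y   = lookup-distinct DC i<j x≈y
    ... | inj₂ x≈y+N = avoids (∈-lookup i) (∈-lookup j) x≈y+N

  -- With g blocks, the set from `foldLoops` has `suc (length S)` - g elements, and `length≤N`
  -- bounds this by `N`.
  zeroSumBlocks : ∀ S → AvoidsN S → ∃₂ λ blocks R →
    S ↭ concat blocks ++ R × All Loop blocks × suc (length S) ≤ N + length blocks
  zeroSumBlocks S avoids with loopErase S
  ... | blocks , R , S↭ , loops , path with foldLoops R loops path (λ σ → avoids (Σ₀-↭ (↭-sym S↭) σ))
  ... | C , _ , DC , diffC , |C| = blocks , R , S↭ , loops , (begin
    suc (length S)                       ≡⟨ cong suc (↭-length S↭) ⟩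
    suc (length (concat blocks ++ R))    ≡⟨ |C| ⟨
    length C + length blocks             ≤⟨ +-monoˡ-≤ (length blocks) (length≤N DC avoidsC) ⟩
    N + length blocks                    ∎)
    where
    open ≤-Reasoning
    avoidsC : ∀ {x y} → x ∈ C → y ∈ C → ¬ x ≈ y + N
    avoidsC x∈ y∈ = Difference≉N (λ σ → avoids (Σ₀-↭ (↭-sym S↭) σ)) (diffC x∈ y∈)

-- The index sets and cube-freeness

-- On ℕ, 0 lies in no layer; layer n + 1 reduces to {0} modulo 2ⁿ.
data InLayer : ℕ → ℕ → Set where
  layer : ∀ {v s} → Val v s → InLayer (suc v) s

InLayer-unique : ∀ {i j s} → InLayer i s → InLayer j s → i ≡ j
InLayer-unique (layer p) (layer q) = cong suc (Val-unique p q)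

extendIndices : ℕ → List ℕ → List ℕ
extendIndices ℓ L = map suc (upTo ℓ) ++ map (λ j → j + ℓ + 1) L

-- Writing d = 2^ℓ + e turns the recursive argument d - 2^ℓ + 1 into `suc e`, free of fuel and
-- truncated subtraction.
data IndexSet : ℕ → List ℕ → Set where
  base : IndexSet 1 []
  step : ∀ {ℓ e L} → 1 ≤ ℓ → e < 2 ^ ℓ → IndexSet (suc e) L → IndexSet (2 ^ ℓ + e) (extendIndices ℓ L)

-- Stated for an arbitrary accessibility proof, so that the induction can follow the halving
-- recursion that defines the logarithm.
⌊log2⌋-bounds : ∀ n (ac : Acc _<_ n) → 1 ≤ n → 2 ^ ⌊log2⌋ n ac ≤ n × n < 2 ^ suc (⌊log2⌋ n ac)
⌊log2⌋-bounds 1 _ _ = ≤-refl , ≤-refl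
⌊log2⌋-bounds (suc (suc n)) (acc rs) _ with ⌊log2⌋-bounds (suc ⌊ n /2⌋) (rs (⌊n/2⌋<n (suc n))) (s≤s z≤n)
... | lower , upper = ≤-trans (*-monoʳ-≤ 2 lower) lo , ≤-trans hi (*-monoʳ-≤ 2 upper)
  where
  lem₁ : ∀ h → 2 * suc h ≡ suc (suc (h + h))
  lem₁ = solve-∀
  lem₂ : ∀ h → 2 * suc (suc h) ≡ suc (suc (suc (h + suc h)))
  lem₂ = solve-∀
  lo : 2 * suc ⌊ n /2⌋ ≤ suc (suc n)
  lo = ≤-trans (≤-reflexive (lem₁ ⌊ n /2⌋)) (s≤s (s≤s
         (≤-trans (+-monoʳ-≤ ⌊ n /2⌋ (⌊n/2⌋≤⌈n/2⌉ n)) (≤-reflexive (⌊n/2⌋+⌈n/2⌉≡n n)))))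
  ceil : ∀ n → ⌈ n /2⌉ ≤ suc ⌊ n /2⌋
  ceil zero = z≤n
  ceil (suc zero) = ≤-refl
  ceil (suc (suc n)) = s≤s (ceil n)
  hi : suc (suc (suc n)) ≤ 2 * suc (suc ⌊ n /2⌋)
  hi = ≤-trans (s≤s (s≤s (s≤s (≤-trans (≤-reflexive (sym (⌊n/2⌋+⌈n/2⌉≡n n))) (+-monoʳ-≤ ⌊ n /2⌋ (ceil n))))))
         (≤-reflexive (sym (lem₂ ⌊ n /2⌋)))

indexSetFuel-IndexSet : ∀ f d → 1 ≤ d → d ≤ f → IndexSet d (indexSetFuel f d)
indexSetFuel-IndexSet (suc f) 1 _ _ = base
indexSetFuel-IndexSet (suc f) d@(suc (suc n)) _ d≤f =
  subst (λ m → IndexSet m (indexSetFuel (suc f) d)) (m+[n∸m]≡n 2^ℓ≤d)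
  (step (s≤s z≤n) e<2^ℓ (subst (λ m → IndexSet m (indexSetFuel f (e + 1))) (+-comm e 1)
    (indexSetFuel-IndexSet f (e + 1) (m≤n+m 1 e) e+1≤f)))
  where
  ℓ e : ℕ
  ℓ = ⌊log₂ d ⌋
  e = d ∸ 2 ^ ℓ
  bounds : 2 ^ ℓ ≤ d × d < 2 ^ suc ℓ
  bounds = ⌊log2⌋-bounds d (<-wellFounded d) (s≤s z≤n)
  2^ℓ≤d : 2 ^ ℓ ≤ d
  2^ℓ≤d = proj₁ bounds
  e<2^ℓ : e < 2 ^ ℓ
  e<2^ℓ = +-cancelˡ-< (2 ^ ℓ) e (2 ^ ℓ) (≤-trans (≤-reflexive (cong suc (m+[n∸m]≡n 2^ℓ≤d)))
    (≤-trans (proj₂ bounds) (≤-reflexive (cong (2 ^ ℓ +_) (+-identityʳ (2 ^ ℓ))))))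
  2≤2^ℓ : 2 ≤ 2 ^ ℓ
  2≤2^ℓ = ^-monoʳ-≤ 2 {1} {ℓ} (s≤s z≤n)
  -- Since 2^ℓ ≥ 2, the recursive argument is smaller than `d`.
  e+1≤f : e + 1 ≤ f
  e+1≤f = s≤s⁻¹ (≤-trans (≤-reflexive (sym (+-suc e 1))) (≤-trans (+-monoʳ-≤ e 2≤2^ℓ)
    (≤-trans (≤-reflexive (m∸n+n≡m 2^ℓ≤d)) d≤f)))

extendIndices-low : ∀ {ℓ u} L → u < ℓ → suc u ∈ extendIndices ℓ L
extendIndices-low {ℓ} L u<ℓ = ∈-++⁺ˡ (∈-map⁺ suc (∈-upTo⁺ u<ℓ))

extendIndices-high : ∀ ℓ {j L} → j ∈ L → j + ℓ + 1 ∈ extendIndices ℓ L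
extendIndices-high ℓ j∈ = ∈-++⁺ʳ (map suc (upTo ℓ)) (∈-map⁺ (λ j → j + ℓ + 1) j∈)

∈-extendIndices⁻ : ∀ ℓ L {i} → i ∈ extendIndices ℓ L →
  (∃ λ u → u < ℓ × i ≡ suc u) ⊎ (∃ λ j → j ∈ L × i ≡ j + ℓ + 1)
∈-extendIndices⁻ ℓ L i∈ with ∈-++⁻ (map suc (upTo ℓ)) i∈
... | inj₁ p with ∈-map⁻ suc p
... | u , u∈ , eq = inj₁ (u , ∈-upTo⁻ u∈ , eq)
∈-extendIndices⁻ ℓ L i∈ | inj₂ p with ∈-map⁻ (λ j → j + ℓ + 1) p
... | j , j∈ , eq = inj₂ (j , j∈ , eq)

IndexSet-positive : ∀ {d L i} → IndexSet d L → i ∈ L → 1 ≤ i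
IndexSet-positive (step {ℓ} {e} {L} _ _ _) i∈ with ∈-extendIndices⁻ ℓ L i∈
... | inj₁ (u , _ , refl) = s≤s z≤n
... | inj₂ (j , _ , refl) = m≤n+m 1 (j + ℓ)

n<2^n : ∀ n → n < 2 ^ n
n<2^n zero    = s≤s z≤n
n<2^n (suc n) = +-mono-≤ {1} {2 ^ n} (m^n>0 2 n) (≤-trans (n<2^n n) (m≤m+n (2 ^ n) 0))

-- The sharper bound for d ≤ 2 (there the sets are empty and {1}) serves the case ℓ = 1, where the
-- recursive argument is at most 2 and i ≤ d alone would lose one. For ℓ ≥ 2 the inequality ℓ + 2 ≤
-- 2^ℓ suffices.
IndexSet-bound : ∀ {d L i} → IndexSet d L → i ∈ L → i ≤ d × (d ≤ 2 → i < d)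
IndexSet-bound (step {ℓ} {e} {L} 1≤ℓ e< I) i∈ with ∈-extendIndices⁻ ℓ L i∈
... | inj₁ (u , u<ℓ , refl) = <⇒≤ lt , λ _ → lt
  where
  lt : suc u < 2 ^ ℓ + e
  lt = ≤-trans (s≤s u<ℓ) (≤-trans (n<2^n ℓ) (m≤m+n (2 ^ ℓ) e))
IndexSet-bound (step {1} {e} {L} 1≤ℓ e< I) i∈ | inj₂ (j , j∈ , refl) with IndexSet-bound I j∈
... | _ , small = ≤-trans (≤-reflexive (lem j)) (+-monoʳ-≤ 2 j≤e) ,
                  λ d≤2 → contradiction
                    (≤-trans (IndexSet-positive I j∈) (≤-trans j≤e (+-cancelˡ-≤ 2 e 0 d≤2))) λ ()
  where
  lem : ∀ j → j + 1 + 1 ≡ 2 + j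
  lem = solve-∀
  j≤e : j ≤ e
  j≤e = s≤s⁻¹ (small e<)
IndexSet-bound (step {suc (suc ℓ)} {e} {L} 1≤ℓ e< I) i∈ | inj₂ (j , j∈ , refl) with IndexSet-bound I j∈
... | j≤ , _ = ≤-trans (+-monoˡ-≤ 1 (+-monoˡ-≤ (2 + ℓ) j≤))
                 (≤-trans (≤-reflexive (lem e ℓ)) (+-monoˡ-≤ e 4+ℓ≤)) ,
               λ d≤2 → contradiction (≤-trans 4+ℓ≤ (≤-trans (m≤m+n _ e) d≤2)) λ { (s≤s (s≤s ())) }
  where
  lem : ∀ e ℓ → suc e + (2 + ℓ) + 1 ≡ (4 + ℓ) + e
  lem = solve-∀
  4+ℓ≤ : 4 + ℓ ≤ 2 ^ (2 + ℓ)
  4+ℓ≤ = ≤-trans (≤-trans (m≤m+n (4 + ℓ) (3 * ℓ)) (≤-reflexive (lem′ ℓ)))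
           (≤-trans (*-monoʳ-≤ 4 (n<2^n ℓ)) (≤-reflexive (*-assoc 2 2 (2 ^ ℓ))))
    where
    lem′ : ∀ ℓ → 4 + ℓ + 3 * ℓ ≡ 4 * suc ℓ
    lem′ = solve-∀

module _ (ℓ : ℕ) where
  open HalfModulus ℓ
  open Congruence M
  open Walk M

  -- The total of a loop is a multiple of `M`, so choosing quotients corresponds to choosing whole
  -- loops.
  blockQuotients : ∀ {blocks} → All Loop blocks → ∃ λ Q → length Q ≡ length blocks
    × (∀ {s} → Σ₀ Q s → Σ₀ (concat blocks) (M * s)) × (∀ {s} → Σ⁺ Q s → Σ⁺ (concat blocks) (M * s))
  blockQuotients [] = [] , refl , (λ { nil → subst (Σ₀ []) (sym (*-zeroʳ M)) nil }) , λ ()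
  blockQuotients {_ ∷ blocks} (loop {a} {S} _ closed ∷ ls) with ≈0⇒∣ closed | blockQuotients ls
  ... | divides c sum≡ | Q , |Q| , f₀ , f⁺ = c ∷ Q , cong suc |Q| , g₀ , g⁺
    where
    total : ∀ s → (a + sum S) + M * s ≡ M * (c + s)
    total s = trans (cong (_+ M * s) (trans sum≡ (*-comm c M))) (sym (*-distribˡ-+ M c s))
    g₀ : ∀ {s} → Σ₀ (c ∷ Q) s → Σ₀ ((a ∷ S) ++ concat blocks) (M * s)
    g₀ (skip σ) = Σ₀-++ (Σ₀-0 (a ∷ S)) (f₀ σ)
    g₀ (take {s = s} σ) = subst (Σ₀ _) (total s) (Σ₀-++ (Σ₀-sum (a ∷ S)) (f₀ σ))
    g⁺ : ∀ {s} → Σ⁺ (c ∷ Q) s → Σ⁺ ((a ∷ S) ++ concat blocks) (M * s)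
    g⁺ (here {s = s} σ) = subst (Σ⁺ _) (total s) (Σ⁺-++ˡ (here (Σ₀-sum S)) (f₀ σ))
    g⁺ (there σ) = Σ⁺-++ʳ (a ∷ S) (f⁺ σ)

OnLayers : List ℕ → ℕ → Set
OnLayers L s = ∃ λ i → i ∈ L × InLayer i s

unlayer : ∀ {v s} → InLayer (suc v) s → Val v s
unlayer (layer p) = p

-- Valuation ℓ means layer ℓ + 1, and this index is skipped: the low indices are at most ℓ and the
-- shifted ones at least ℓ + 2.
OnLayers⇒¬Val : ∀ ℓ {L s} → (∀ {j} → j ∈ L → 1 ≤ j) → OnLayers (extendIndices ℓ L) s → ¬ Val ℓ s
OnLayers⇒¬Val ℓ {L} {s} L>0 (i , i∈ , inL) s-val with ∈-extendIndices⁻ ℓ L i∈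
... | inj₁ (u , u<ℓ , refl) = <-irrefl (Val-unique (unlayer inL) s-val) u<ℓ
... | inj₂ (j , j∈ , i≡)  = <-irrefl (trans (InLayer-unique (layer s-val) inL) i≡)
        (≤-trans (≤-reflexive (cong suc (+-comm 1 ℓ)))
          (≤-trans (+-monoˡ-≤ (ℓ + 1) (L>0 j∈)) (≤-reflexive (sym (+-assoc j ℓ 1)))))

-- A multiple of 2^(ℓ+1) lies in none of the low layers, and division by 2^(ℓ+1) undoes the shift of
-- the others.
OnLayers-unscale : ∀ ℓ {L s} → (∀ {j} → j ∈ L → 1 ≤ j) →
  OnLayers (extendIndices ℓ L) (2 ^ suc ℓ * s) → OnLayers L s
OnLayers-unscale ℓ {L} {s} L>0 (i , i∈ , inL) with ∈-extendIndices⁻ ℓ L i∈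
... | inj₁ (u , u<ℓ , refl) =
  contradiction (∣m⇒∣m*n s (2^-mono-∣ (n≤1+n ℓ))) (Val⇒∤ (unlayer inL) u<ℓ)
... | inj₂ (zero , j∈ , _) = contradiction (L>0 j∈) λ ()
... | inj₂ (suc v , j∈ , i≡) =
  suc v , j∈ , layer (Val-unscale (suc ℓ)
    (unlayer (subst (λ i → InLayer i (2 ^ suc ℓ * s)) (trans i≡ (lem v ℓ)) inL)))
  where
  lem : ∀ v ℓ → suc v + ℓ + 1 ≡ suc (suc ℓ + v)
  lem = solve-∀

avoidsHalf : ∀ ℓ {L} S → (∀ {j} → j ∈ L → 1 ≤ j) →
  (∀ {s} → Σ⁺ S s → OnLayers (extendIndices ℓ L) s) → HalfModulus.AvoidsN ℓ S
avoidsHalf ℓ S L>0 cube σ s≈N with Σ₀⇒≡0⊎Σ⁺ σ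
... | inj₁ refl = <-irrefl refl (Val⇒>0 (HalfModulus.≈N⇒Val ℓ s≈N))
... | inj₂ σ⁺   = OnLayers⇒¬Val ℓ L>0 (cube σ⁺) (HalfModulus.≈N⇒Val ℓ s≈N)

-- From 2^ℓ + e elements at least e + 1 blocks arise, and e + 1 is the argument of the recursive
-- index set `L`.
quotientCube : ∀ ℓ {L e} S → (∀ {j} → j ∈ L → 1 ≤ j) → 2 ^ ℓ + e ≤ length S →
  (∀ {s} → Σ⁺ S s → OnLayers (extendIndices ℓ L) s) →
  ∃ λ Q → suc e ≤ length Q × (∀ {s} → Σ⁺ Q s → OnLayers L s)
quotientCube ℓ {L} {e} S L>0 d≤ cube with HalfModulus.zeroSumBlocks ℓ S (avoidsHalf ℓ S L>0 cube)
... | blocks , R , S↭ , loops , bound with blockQuotients ℓ loops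
... | Q , |Q| , _ , f⁺ = Q , e<|Q| , λ {s} σ → OnLayers-unscale ℓ L>0 (cube (Σ⁺-↭ (↭-sym S↭)
    (subst (Σ⁺ (concat blocks ++ R)) (+-identityʳ (2 ^ suc ℓ * s)) (Σ⁺-++ˡ (f⁺ σ) (Σ₀-0 R)))))
  where
  N : ℕ
  N = 2 ^ ℓ
  e<|Q| : suc e ≤ length Q
  e<|Q| = +-cancelˡ-≤ N (suc e) (length Q) (≤-trans (≤-reflexive (+-suc N e))
            (≤-trans (s≤s d≤) (≤-trans bound (≤-reflexive (cong (N +_) (sym |Q|))))))

IndexSet-cubeFree : ∀ {d L} → IndexSet d L → ∀ S → d ≤ length S → ¬ (∀ {s} → Σ⁺ S s → OnLayers L s)
IndexSet-cubeFree base (a ∷ S) _ cube with cube (here (Σ₀-0 S))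
... | _ , () , _
IndexSet-cubeFree (step {ℓ} {e} {L} _ _ I) S d≤ cube with quotientCube ℓ S (IndexSet-positive I) d≤ cube
... | Q , e<|Q| , cubeQ = IndexSet-cubeFree I Q e<|Q| cubeQ

-- Cubes through a missing layer

Σ₀-ones : ∀ m {T s} → Σ₀ (replicate m 1 ++ T) s → ∃₂ λ j t → j ≤ m × Σ₀ T t × s ≡ j + t
Σ₀-ones zero {s = s} σ = 0 , s , z≤n , σ , refl
Σ₀-ones (suc m) (skip σ) with Σ₀-ones m σ
... | j , t , j≤m , τ , eq = j , t , m≤n⇒m≤1+n j≤m , τ , eq
Σ₀-ones (suc m) (take σ) with Σ₀-ones m σ
... | j , t , j≤m , τ , eq = suc j , t , s≤s j≤m , τ , cong suc eq

Σ⁺-ones : ∀ m {T s} → Σ⁺ (replicate m 1 ++ T) s →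
  ∃₂ λ j t → j ≤ m × s ≡ j + t × ((0 < j × Σ₀ T t) ⊎ Σ⁺ T t)
Σ⁺-ones zero {s = s} σ = 0 , s , z≤n , refl , inj₂ σ
Σ⁺-ones (suc m) (here σ) with Σ₀-ones m σ
... | j , t , j≤m , τ , eq = suc j , t , s≤s j≤m , cong suc eq , inj₁ (s≤s z≤n , τ)
Σ⁺-ones (suc m) (there σ) with Σ⁺-ones m σ
... | j , t , j≤m , eq , τ = j , t , m≤n⇒m≤1+n j≤m , eq , τ

Σ₀-scale⁻ : ∀ c S {s} → Σ₀ (map (c *_) S) s → ∃ λ u → Σ₀ S u × s ≡ c * u
Σ₀-scale⁻ c [] nil = 0 , nil , sym (*-zeroʳ c)
Σ₀-scale⁻ c (a ∷ S) (skip σ) with Σ₀-scale⁻ c S σ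
... | u , τ , eq = u , skip τ , eq
Σ₀-scale⁻ c (a ∷ S) (take σ) with Σ₀-scale⁻ c S σ
... | u , τ , refl = a + u , take τ , sym (*-distribˡ-+ c a u)

Σ⁺-scale⁻ : ∀ c S {s} → Σ⁺ (map (c *_) S) s → ∃ λ u → Σ⁺ S u × s ≡ c * u
Σ⁺-scale⁻ c (a ∷ S) (here σ) with Σ₀-scale⁻ c S σ
... | u , τ , refl = a + u , here τ , sym (*-distribˡ-+ c a u)
Σ⁺-scale⁻ c (a ∷ S) (there σ) with Σ⁺-scale⁻ c S σ
... | u , τ , eq = u , there τ , eq

-- These are the layers sure to be present in a union whose index list first differs from `L` by
-- containing `k`.
Exchanged : List ℕ → ℕ → ℕ → Set
Exchanged L k s = ∃ λ i → InLayer i s × ((i ∈ L × i < k) ⊎ i ≡ k)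

-- The sums are 1, ..., d, all below 2^(ℓ+1), so their valuations are at most ℓ.
onesCube : ∀ ℓ L d → d < 2 ^ suc ℓ → ∀ {s} → Σ⁺ (replicate d 1 ++ []) s →
  Exchanged (extendIndices ℓ L) (suc ℓ) s
onesCube ℓ L d d< σ with Σ⁺-ones d σ
... | suc j , _ , j≤d , refl , inj₁ (_ , nil) with ∤⇒Val (suc ℓ) (suc j + 0)
        (>⇒∤ (≤-trans (s≤s (≤-trans (≤-reflexive (+-identityʳ (suc j))) j≤d)) d<))
... | v , v< , p with m≤n⇒m<n∨m≡n (s≤s⁻¹ v<)
... | inj₁ v<ℓ  = suc v , layer p , inj₁ (extendIndices-low L v<ℓ , s≤s v<ℓ)
... | inj₂ refl = suc v , layer p , inj₂ refl

-- The first element `suc c` is the b₁ of the construction; its positivity keeps M b₁ - (N - 1) a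
-- natural number. Replacing it by `N` elements turns a cube of size e + 1 into one of size N + e.
module Lift (ℓ k c : ℕ) (L S : List ℕ) (k>0 : 0 < k) (cube : ∀ {s} → Σ⁺ (suc c ∷ S) s → Exchanged L k s) where
  N M w : ℕ
  N = 2 ^ ℓ
  M = 2 ^ suc ℓ
  -- chosen so that N - 1 ones together with w sum to M (1 + c)
  w = M * c + suc N

  lifted : List ℕ
  lifted = replicate (pred N) 1 ++ w ∷ map (M *_) S

  length-lifted : length lifted ≡ N + length S
  length-lifted = begin
    length lifted
      ≡⟨ length-++ (replicate (pred N) 1) ⟩
    length (replicate (pred N) 1) + suc (length (map (M *_) S))
      ≡⟨ cong₂ (λ x y → x + suc y) (length-replicate (pred N)) (length-map (M *_) S) ⟩
    pred N + suc (length S)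
      ≡⟨ +-suc (pred N) (length S) ⟩
    suc (pred N) + length S
      ≡⟨ cong (_+ length S) (suc-pred N {{m^n≢0 2 ℓ}}) ⟩
    N + length S ∎
    where open ≡-Reasoning

  k′ : ℕ
  k′ = k + ℓ + 1

  -- Such a sum is not divisible by `N`, so it falls into one of the layers 1, ..., ℓ, all of which
  -- are present and precede `k′`.
  low : ∀ {j} y → 0 < j → j < N → Exchanged (extendIndices ℓ L) k′ (j + N * y)
  low {j} y 0<j j<N with ∤⇒Val ℓ (j + N * y)
    (λ d → >⇒∤ {{>-nonZero 0<j}} j<N (∣m+n∣m⇒∣n (subst (N ∣_) (+-comm j (N * y)) d) (m∣m*n y)))
  ... | v , v<ℓ , p = suc v , layer p , inj₁ (extendIndices-low L v<ℓ ,
    ≤-trans (s≤s v<ℓ) (≤-trans (m≤n+m (suc ℓ) k)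
      (≤-reflexive (trans (cong (k +_) (+-comm 1 ℓ)) (sym (+-assoc k ℓ 1))))))

  high : ∀ {u} → Σ⁺ (suc c ∷ S) u → Exchanged (extendIndices ℓ L) k′ (M * u)
  high {u} σ with cube σ
  ... | suc v , layer p , where-is =
    suc v + ℓ + 1 , subst (λ i → InLayer i (M * u)) (lem ℓ v) (layer (Val-scale (suc ℓ) p)) , shifted where-is
    where
    lem : ∀ ℓ v → suc (suc ℓ + v) ≡ suc v + ℓ + 1
    lem = solve-∀
    shifted : ((suc v ∈ L × suc v < k) ⊎ suc v ≡ k) →
      ((suc v + ℓ + 1 ∈ extendIndices ℓ L × suc v + ℓ + 1 < k′) ⊎ suc v + ℓ + 1 ≡ k′)
    shifted (inj₁ (v∈ , v<k)) = inj₁ (extendIndices-high ℓ v∈ , +-monoˡ-≤ 1 (+-monoˡ-≤ ℓ v<k))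
    shifted (inj₂ refl) = inj₂ refl

  -- Since `w` is 1 modulo `N`, the sum is j + 1 modulo `N`, hence low unless all N - 1 ones occur;
  -- in that case it is `M` times a sum of the original cube that uses `suc c`.
  with-w : ∀ {j u} → j ≤ pred N → Σ₀ S u → Exchanged (extendIndices ℓ L) k′ (j + (w + M * u))
  with-w {j} {u} j≤ σ with m≤n⇒m<n∨m≡n (≤-trans (s≤s j≤) (≤-reflexive (suc-pred N {{m^n≢0 2 ℓ}})))
  ... | inj₁ j+1<N = subst (Exchanged _ k′) (lem N j c u) (low (suc (2 * (c + u))) (s≤s z≤n) j+1<N)
    where
    lem : ∀ n j c u → suc j + n * suc (2 * (c + u)) ≡ j + ((2 * n) * c + suc n + (2 * n) * u)
    lem = solve-∀
  ... | inj₂ j+1≡N = subst (Exchanged _ k′) eq (high (here σ))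
    where
    lem : ∀ n j c u → suc j + (2 * n * c + n + 2 * n * u) ≡ j + ((2 * n) * c + suc n + (2 * n) * u)
    lem = solve-∀
    lem′ : ∀ n c u → 2 * n * (suc c + u) ≡ n + (2 * n * c + n + 2 * n * u)
    lem′ = solve-∀
    eq : M * (suc c + u) ≡ j + (w + M * u)
    eq = trans (lem′ N c u) (trans (cong (_+ (2 * N * c + N + 2 * N * u)) (sym j+1≡N)) (lem N j c u))

  -- Three kinds of sums: those with `w`; those with ones but without `w`, nonzero modulo `N`; and
  -- those with neither, which are `M` times a nonempty sum from `S`.
  lifted-cube : ∀ {s} → Σ⁺ lifted s → Exchanged (extendIndices ℓ L) k′ s
  lifted-cube σ with Σ⁺-ones (pred N) σ
  ... | j , t , j≤ , refl , inj₂ (here τ) with Σ₀-scale⁻ M S τ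
  ... | u , τ′ , refl = with-w j≤ τ′
  lifted-cube σ | j , t , j≤ , refl , inj₁ (0<j , take τ) with Σ₀-scale⁻ M S τ
  ... | u , τ′ , refl = with-w j≤ τ′
  lifted-cube σ | j , t , j≤ , refl , inj₁ (0<j , skip τ) with Σ₀-scale⁻ M S τ
  ... | u , τ′ , refl = subst (Exchanged _ k′) (cong (j +_) (lem N u)) (low (2 * u) 0<j j<N)
    where
    lem : ∀ n u → n * (2 * u) ≡ 2 * n * u
    lem = solve-∀
    j<N : j < N
    j<N = ≤-trans (s≤s j≤) (≤-reflexive (suc-pred N {{m^n≢0 2 ℓ}}))
  lifted-cube σ | zero , t , j≤ , refl , inj₂ (there τ) with Σ⁺-scale⁻ M S τ
  ... | u , τ′ , refl = high (there τ′)
  lifted-cube σ | j@(suc _) , t , j≤ , refl , inj₂ (there τ) with Σ⁺-scale⁻ M S τ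
  ... | u , τ′ , refl = subst (Exchanged _ k′) (cong (j +_) (lem N u)) (low (2 * u) (s≤s z≤n) j<N)
    where
    lem : ∀ n u → n * (2 * u) ≡ 2 * n * u
    lem = solve-∀
    j<N : j < N
    j<N = ≤-trans (s≤s j≤) (≤-reflexive (suc-pred N {{m^n≢0 2 ℓ}}))

InLayer⇒>0 : ∀ {i s} → InLayer i s → 0 < s
InLayer⇒>0 (layer p) = Val⇒>0 p

exchangeCube : ∀ {d L} → IndexSet d L → ∀ k → 0 < k → ¬ k ∈ L →
  ∃ λ S → length S ≡ d × (∀ {s} → Σ⁺ S s → Exchanged L k s)
exchangeCube base (suc v) _ _ = 2 ^ v ∷ [] , refl , λ
  { (here nil) → suc v , layer (val 0 (trans (+-identityʳ (2 ^ v)) (sym (*-identityʳ (2 ^ v))))) , inj₂ refl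
  ; (there ()) }
exchangeCube (step {ℓ} {e} {L} 1≤ℓ e< I) k 0<k k∉ with <-cmp k (suc ℓ)
-- All layers 1, ..., ℓ are present, so a missing `k` is at least ℓ + 1.
exchangeCube (step {ℓ} {e} {L} 1≤ℓ e< I) (suc k) 0<k k∉ | tri< k<ℓ _ _ =
  contradiction (extendIndices-low L (s≤s⁻¹ k<ℓ)) k∉
... | tri≈ _ refl _ =
  replicate d 1 ++ [] ,
  trans (length-++ (replicate d 1)) (trans (+-identityʳ _) (length-replicate d)) ,
  onesCube ℓ L d d<
  where
  d : ℕ
  d = 2 ^ ℓ + e
  d< : d < 2 ^ suc ℓ
  d< = ≤-trans (+-monoʳ-< (2 ^ ℓ) e<) (≤-reflexive (cong (2 ^ ℓ +_) (sym (+-identityʳ (2 ^ ℓ)))))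
-- The unshifted index is again missing from `L`, for otherwise its shift `k` would be present.
... | tri> _ _ ℓ<k = lift (exchangeCube I k₀ (m<n⇒0<n∸m ℓ<k)
    (λ k₀∈ → k∉ (subst (_∈ extendIndices ℓ L) k₀+ℓ+1≡k (extendIndices-high ℓ k₀∈))))
  where
  k₀ : ℕ
  k₀ = k ∸ suc ℓ
  k₀+ℓ+1≡k : k₀ + ℓ + 1 ≡ k
  k₀+ℓ+1≡k = trans (+-assoc k₀ ℓ 1) (trans (cong (k₀ +_) (+-comm ℓ 1)) (m∸n+n≡m (<⇒≤ ℓ<k)))
  lift : (∃ λ S → length S ≡ suc e × (∀ {s} → Σ⁺ S s → Exchanged L k₀ s)) →
    ∃ λ S → length S ≡ 2 ^ ℓ + e × (∀ {s} → Σ⁺ S s → Exchanged (extendIndices ℓ L) k s)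
  -- Each element of the cube is itself a subset sum, so it lies in a layer and is positive.
  lift (zero ∷ S , |S| , cube) = contradiction (InLayer⇒>0 (proj₁ (proj₂ (cube (here (Σ₀-0 S)))))) λ ()
  lift (suc c ∷ S , |S| , cube) = lifted , trans length-lifted (cong (2 ^ ℓ +_) (suc-injective |S|)) ,
    λ σ → subst (λ k → Exchanged (extendIndices ℓ L) k _) k₀+ℓ+1≡k (lifted-cube σ)
    where open Lift ℓ k₀ c L S (m<n⇒0<n∸m ℓ<k) cube

-- Layers of ℤ/2ⁿ

∈-LayerUnion⁻ : ∀ n J {x} → x Subset.∈ LayerUnion n J → ∃ λ i → i ∈ J × T (inLayerᵇ n i (toℕ x))
∈-LayerUnion⁻ n [] x∈ = ⊥-elim (∉⊥ x∈)
∈-LayerUnion⁻ n (i ∷ J) {x} x∈ with x∈p∪q⁻ (Layer n i) (LayerUnion n J) x∈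
... | inj₁ x∈L = i , here refl , Equivalence.from T-≡
                   (trans (sym (lookup∘tabulate (λ x → inLayerᵇ n i (toℕ x)) x)) ([]=⇒lookup x∈L))
... | inj₂ x∈U with ∈-LayerUnion⁻ n J x∈U
... | j , j∈ , p = j , there j∈ , p

∈-LayerUnion⁺ : ∀ n {J x i} → i ∈ J → T (inLayerᵇ n i (toℕ x)) → x Subset.∈ LayerUnion n J
∈-LayerUnion⁺ n {i ∷ J} {x} (here refl) p = x∈p∪q⁺ (inj₁ (lookup⇒[]= x (Layer n i)
  (trans (lookup∘tabulate (λ x → inLayerᵇ n i (toℕ x)) x) (Equivalence.to T-≡ p))))
∈-LayerUnion⁺ n (there i∈) p = x∈p∪q⁺ (inj₂ (∈-LayerUnion⁺ n i∈ p))

2^v%2^1+v≡2^v : ∀ v → _%_ (2 ^ v) (2 ^ suc v) {{m^n≢0 2 (suc v)}} ≡ 2 ^ v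
2^v%2^1+v≡2^v v = m<n⇒m%n≡m {{m^n≢0 2 (suc v)}} (^-monoʳ-< 2 (s≤s (s≤s z≤n)) (n<1+n v))

-- Layer v + 1 is the class of N modulo M in `HalfModulus v`.
InLayer⇒% : ∀ v {s} → InLayer (suc v) s → _%_ s (2 ^ suc v) {{m^n≢0 2 (suc v)}} ≡ 2 ^ v
InLayer⇒% v (layer p) = trans (%≡⁻ (Val⇒≈N p)) (2^v%2^1+v≡2^v v)
  where
  open HalfModulus v
  open Congruence M

%⇒InLayer : ∀ v {s} → _%_ s (2 ^ suc v) {{m^n≢0 2 (suc v)}} ≡ 2 ^ v → InLayer (suc v) s
%⇒InLayer v eq = layer (≈N⇒Val (%≡ (trans eq (sym (2^v%2^1+v≡2^v v)))))
  where
  open HalfModulus v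
  open Congruence M

module Residues (n : ℕ) where
  instance
    2^n≢0 : NonZero (2 ^ n)
    2^n≢0 = m^n≢0 2 n

  open Congruence (2 ^ n)

  InLayer-resp-% : ∀ {i} s → i ≤ n → InLayer i (s % 2 ^ n) → InLayer i s
  InLayer-resp-% {suc v} s i≤n p = %⇒InLayer v (trans
    (sym (m∣n⇒o%n%m≡o%m (2 ^ suc v) (2 ^ n) s {{m^n≢0 2 (suc v)}} (2^-mono-∣ i≤n))) (InLayer⇒% v p))

  inLayerᵇ⁻ : ∀ i x → T (inLayerᵇ n i x) → (i ≤ n × InLayer i x) ⊎ (i ≡ suc n × x ≡ 0)
  inLayerᵇ⁻ i x p with Equivalence.to T-∨ p
  inLayerᵇ⁻ (suc v) x p | inj₁ q with Equivalence.to T-∧ q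
  ... | i≤n , r≡ = inj₁ (≤ᵇ⇒≤ (suc v) n i≤n , %⇒InLayer v (≡ᵇ⇒≡ _ _ r≡))
  inLayerᵇ⁻ i x p | inj₂ q with Equivalence.to (T-∧ {i ≡ᵇ suc n}) q
  ... | i≡ , x≡ = inj₂ (≡ᵇ⇒≡ i (suc n) i≡ , ≡ᵇ⇒≡ x 0 x≡)

  inLayerᵇ⁺ : ∀ {i} s → i ≤ suc n → InLayer i s → T (inLayerᵇ n i (s % 2 ^ n))
  inLayerᵇ⁺ {suc v} s i≤ p with m≤n⇒m<n∨m≡n i≤
  ... | inj₁ (s≤s v<n) = Equivalence.from T-∨ (inj₁ (Equivalence.from T-∧ (≤⇒≤ᵇ v<n , ≡⇒≡ᵇ _ _
    (trans (m∣n⇒o%n%m≡o%m (2 ^ suc v) (2 ^ n) s {{m^n≢0 2 (suc v)}} (2^-mono-∣ v<n)) (InLayer⇒% v p)))))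
  -- In layer n + 1 the valuation is n, so the residue modulo 2^n is 0.
  inLayerᵇ⁺ {suc v} s i≤ (layer p) | inj₂ refl = Equivalence.from T-∨ (inj₂ (Equivalence.from (T-∧ {v ≡ᵇ v})
    (≡⇒≡ᵇ v v refl , ≡⇒≡ᵇ _ _ (n∣m⇒m%n≡0 s (2 ^ n) (Val⇒∣ p ≤-refl)))))

  toℕ-mod : ∀ s → toℕ (s mod 2 ^ n) ≡ s % 2 ^ n
  toℕ-mod s = Finₚ.toℕ-fromℕ< (m%n<n s (2 ^ n))

  Σ₀⇒subsetSum : ∀ {d} (a : Vec (Fin (2 ^ n)) d) {s} → Σ₀ (Vec.toList (Vec.map toℕ a)) s →
    ∃ λ I → subsetSumℕ a I ≡ s
  Σ₀⇒subsetSum [] nil = [] , refl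
  Σ₀⇒subsetSum (x ∷ a) (skip σ) with Σ₀⇒subsetSum a σ
  ... | I , eq = outside ∷ I , eq
  Σ₀⇒subsetSum (x ∷ a) (take σ) with Σ₀⇒subsetSum a σ
  ... | I , eq = inside ∷ I , cong (toℕ x +_) eq

  Σ⁺⇒subsetSum : ∀ {d} (a : Vec (Fin (2 ^ n)) d) {s} → Σ⁺ (Vec.toList (Vec.map toℕ a)) s →
    ∃ λ I → Nonempty I × subsetSumℕ a I ≡ s
  Σ⁺⇒subsetSum (x ∷ a) (here σ) with Σ₀⇒subsetSum a σ
  ... | I , eq = inside ∷ I , (Fin.zero , Vec.here) , cong (toℕ x +_) eq
  Σ⁺⇒subsetSum (x ∷ a) (there σ) with Σ⁺⇒subsetSum a σ
  ... | I , (i , i∈) , eq = outside ∷ I , (Fin.suc i , Vec.there i∈) , eq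

  residues : (S : List ℕ) → Vec (Fin (2 ^ n)) (length S)
  residues S = Vec.map (λ s → s mod 2 ^ n) (Vec.fromList S)

  mod≈ : ∀ s → toℕ (s mod 2 ^ n) ≈ s
  mod≈ s = %≡ (trans (cong (_% 2 ^ n) (toℕ-mod s)) (m%n%n≡m%n s (2 ^ n)))

  subsetSum-residues₀ : ∀ S (I : Subset (length S)) → ∃ λ s → Σ₀ S s × subsetSumℕ (residues S) I ≈ s
  subsetSum-residues₀ [] [] = 0 , nil , ≈-refl
  subsetSum-residues₀ (a ∷ S) (inside ∷ I) with subsetSum-residues₀ S I
  ... | s , σ , eq = a + s , take σ , +-cong-≈ (mod≈ a) eq
  subsetSum-residues₀ (a ∷ S) (outside ∷ I) with subsetSum-residues₀ S I
  ... | s , σ , eq = s , skip σ , eq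

  subsetSum-residues⁺ : ∀ S (I : Subset (length S)) → Nonempty I →
    ∃ λ s → Σ⁺ S s × subsetSumℕ (residues S) I ≈ s
  subsetSum-residues⁺ (a ∷ S) (inside ∷ I) _ with subsetSum-residues₀ S I
  ... | s , σ , eq = a + s , here σ , +-cong-≈ (mod≈ a) eq
  subsetSum-residues⁺ (a ∷ S) (outside ∷ I) (Fin.suc i , Vec.there i∈) with subsetSum-residues⁺ S I (i , i∈)
  ... | s , σ , eq = s , there σ , eq

  LayerUnion-cubeFree : ∀ {d L} → IndexSet d L → d ≤ n → CubeFree n d (LayerUnion n L)
  LayerUnion-cubeFree {d} {L} I d≤n (a , cube) =
    IndexSet-cubeFree I (Vec.toList (Vec.map toℕ a))
      (≤-reflexive (sym (length-toList (Vec.map toℕ a)))) onLayers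
    where
    onLayers : ∀ {s} → Σ⁺ (Vec.toList (Vec.map toℕ a)) s → OnLayers L s
    onLayers {s} σ with Σ⁺⇒subsetSum a σ
    ... | K , K≠∅ , refl with ∈-LayerUnion⁻ n L (cube K K≠∅)
    ... | i , i∈ , p with inLayerᵇ⁻ i _ p | proj₁ (IndexSet-bound I i∈)
    ... | inj₁ (i≤n , inL) | _ = i , i∈ , InLayer-resp-% s i≤n (subst (InLayer i) (toℕ-mod s) inL)
    -- Layer n + 1 does not occur, because every index is at most d ≤ n.
    ... | inj₂ (refl , _) | i≤d = contradiction (≤-trans i≤d d≤n) 1+n≰n

  cubeIn-LayerUnion : ∀ J S → (∀ {s} → Σ⁺ S s → ∃ λ i → i ∈ J × i ≤ suc n × InLayer i s) →
    ¬ CubeFree n (length S) (LayerUnion n J)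
  cubeIn-LayerUnion J S cube free = free (residues S , λ I I≠∅ → member I I≠∅)
    where
    member : ∀ I → Nonempty I → subsetSum n (residues S) I Subset.∈ LayerUnion n J
    member I I≠∅ with subsetSum-residues⁺ S I I≠∅
    ... | s , σ , eq with cube σ
    ... | i , i∈ , i≤ , inL = ∈-LayerUnion⁺ n i∈
      (subst (T ∘ inLayerᵇ n i) (sym (trans (toℕ-mod _) (%≡⁻ eq))) (inLayerᵇ⁺ s i≤ inL))

-- Comparing the sizes of unions of layers

∣∣-mono-injection : ∀ {m k} (p : Subset m) (q : Subset k) (f : Fin m → Fin k) →
  (∀ {x} → x Subset.∈ p → f x Subset.∈ q) →
  (∀ {x y} → x Subset.∈ p → y Subset.∈ p → f x ≡ f y → x ≡ y) → ∣ p ∣ ≤ ∣ q ∣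
∣∣-mono-injection [] q f f∈ inj = z≤n
∣∣-mono-injection (outside ∷ p) q f f∈ inj = ∣∣-mono-injection p q (f ∘ Fin.suc) (f∈ ∘ Vec.there)
  λ x∈ y∈ eq → Finₚ.suc-injective (inj (Vec.there x∈) (Vec.there y∈) eq)
∣∣-mono-injection (inside ∷ p) q f f∈ inj = ≤-trans (s≤s (∣∣-mono-injection p (q - f Fin.zero) (f ∘ Fin.suc)
  (λ x∈ → x∈p∧x≢y⇒x∈p-y (f∈ (Vec.there x∈)) λ eq → Finₚ.0≢1+n (sym (inj (Vec.there x∈) Vec.here eq)))
  λ x∈ y∈ eq → Finₚ.suc-injective (inj (Vec.there x∈) (Vec.there y∈) eq)))
  (x∈p⇒∣p-x∣<∣p∣ (f∈ Vec.here))

-- Index 0 is left out because layer 0 is empty and may be listed freely.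
Agree : List ℕ → List ℕ → ℕ → Set
Agree J L m = ∀ {i} → 0 < i → i < m → (i ∈ J → i ∈ L) × (i ∈ L → i ∈ J)

firstDifference : ∀ J L m → Agree J L m ⊎
  (∃ λ k → 0 < k × k < m × Agree J L k × ((k ∈ J × ¬ k ∈ L) ⊎ (k ∈ L × ¬ k ∈ J)))
firstDifference J L zero = inj₁ λ _ ()
firstDifference J L (suc m) with firstDifference J L m
... | inj₂ (k , 0<k , k<m , rest) = inj₂ (k , 0<k , m≤n⇒m≤1+n k<m , rest)
firstDifference J L (suc zero) | inj₁ _ = inj₁ λ { (s≤s _) (s≤s ()) }
firstDifference J L (suc m@(suc _)) | inj₁ agree with m ∈? J | m ∈? L
... | yes m∈J | no m∉L = inj₂ (m , s≤s z≤n , ≤-refl , agree , inj₁ (m∈J , m∉L))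
... | no m∉J | yes m∈L = inj₂ (m , s≤s z≤n , ≤-refl , agree , inj₂ (m∈L , m∉J))
... | yes m∈J | yes m∈L = inj₁ extended
  where
  extended : Agree J L (suc m)
  extended 0<i i<1+m with m≤n⇒m<n∨m≡n (s≤s⁻¹ i<1+m)
  ... | inj₁ i<m  = agree 0<i i<m
  ... | inj₂ refl = (λ _ → m∈L) , (λ _ → m∈J)
... | no m∉J | no m∉L = inj₁ extended
  where
  extended : Agree J L (suc m)
  extended 0<i i<1+m with m≤n⇒m<n∨m≡n (s≤s⁻¹ i<1+m)
  ... | inj₁ i<m  = agree 0<i i<m
  ... | inj₂ refl = (λ m∈J → contradiction m∈J m∉J) , (λ m∈L → contradiction m∈L m∉L)

module _ (n : ℕ) where
  open Residues n
  open Congruence (2 ^ n)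

  InLayer⇒1≤ : ∀ {i s} → InLayer i s → 0 < i
  InLayer⇒1≤ (layer _) = s≤s z≤n

  -- Only the indices 1, ..., n + 1 name nonempty layers, so agreement below n + 2 settles
  -- membership.
  agree⇒∣∣≤ : ∀ J L → Agree J L (suc (suc n)) → ∣ LayerUnion n J ∣ ≤ ∣ LayerUnion n L ∣
  agree⇒∣∣≤ J L agree = p⊆q⇒∣p∣≤∣q∣ λ x∈ → transfer (∈-LayerUnion⁻ n J x∈)
    where
    transfer : ∀ {x} → (∃ λ i → i ∈ J × T (inLayerᵇ n i (toℕ x))) → x Subset.∈ LayerUnion n L
    transfer {x} (i , i∈ , p) with inLayerᵇ⁻ i (toℕ x) p
    ... | inj₁ (i≤n , inL) = ∈-LayerUnion⁺ n (proj₁ (agree (InLayer⇒1≤ inL) (s≤s (m≤n⇒m≤1+n i≤n))) i∈) p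
    ... | inj₂ (refl , _) = ∈-LayerUnion⁺ n (proj₁ (agree (s≤s z≤n) ≤-refl) i∈) p

  -- L contains the whole layer k, and translation by 2^(k-1) embeds the multiples of 2^k in it.
  first-missing⇒∣∣≤ : ∀ J L v → suc v ≤ n → Agree J L (suc v) → suc v ∈ L → ¬ suc v ∈ J →
    ∣ LayerUnion n J ∣ ≤ ∣ LayerUnion n L ∣
  first-missing⇒∣∣≤ J L v k≤n agree k∈L k∉J =
    ∣∣-mono-injection (LayerUnion n J) (LayerUnion n L) f f∈ f-injective
    where
    k : ℕ
    k = suc v
    f′ : ∀ x → Dec (2 ^ k ∣ toℕ x) → Fin (2 ^ n)
    f′ x (yes _) = (toℕ x + 2 ^ v) mod 2 ^ n
    f′ x (no _)  = x
    f : Fin (2 ^ n) → Fin (2 ^ n)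
    f x = f′ x (2 ^ k ∣? toℕ x)
    translate : ∀ {x} → 2 ^ k ∣ x → InLayer k (x + 2 ^ v)
    translate (divides c refl) = layer (val c (lem c (2 ^ v)))
      where
      lem : ∀ c h → c * (2 * h) + h ≡ h * suc (2 * c)
      lem = solve-∀
    translate-mod : ∀ {x} → 2 ^ k ∣ x → T (inLayerᵇ n k (toℕ ((x + 2 ^ v) mod 2 ^ n)))
    translate-mod {x} d = subst (T ∘ inLayerᵇ n k) (sym (toℕ-mod (x + 2 ^ v)))
      (inLayerᵇ⁺ (x + 2 ^ v) (m≤n⇒m≤1+n k≤n) (translate d))
    -- 0 and all layers beyond `k` consist of multiples of 2^k, and `k` itself is missing from `J`,
    -- so only earlier layers remain.
    below : ∀ {x} → x Subset.∈ LayerUnion n J → ¬ 2 ^ k ∣ toℕ x →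
      ∃ λ i → i ∈ J × i < k × InLayer i (toℕ x) × T (inLayerᵇ n i (toℕ x))
    below {x} x∈ ¬d with ∈-LayerUnion⁻ n J x∈
    ... | i , i∈ , p with inLayerᵇ⁻ i (toℕ x) p
    ... | inj₂ (_ , x≡0) = contradiction (subst (2 ^ k ∣_) (sym x≡0) ((2 ^ k) ∣0)) ¬d
    ... | inj₁ (_ , layer {u} q) with <-cmp (suc u) k
    ... | tri< i<k _ _  = suc u , i∈ , i<k , layer q , p
    ... | tri≈ _ refl _ = contradiction i∈ k∉J
    ... | tri> _ _ k<i  = contradiction (Val⇒∣ q (s≤s⁻¹ k<i)) ¬d
    f∈ : ∀ {x} → x Subset.∈ LayerUnion n J → f x Subset.∈ LayerUnion n L
    f∈ {x} x∈ with 2 ^ k ∣? toℕ x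
    ... | yes d = ∈-LayerUnion⁺ n k∈L (translate-mod d)
    ... | no ¬d with below x∈ ¬d
    ... | i , i∈ , i<k , inL , p = ∈-LayerUnion⁺ n (proj₁ (agree (InLayer⇒1≤ inL) i<k) i∈) p
    -- A translated point lands in layer `k`, while a fixed point stays in a layer before `k`, so
    -- their images differ.
    mixed : ∀ {x y} → y Subset.∈ LayerUnion n J → 2 ^ k ∣ toℕ x → ¬ 2 ^ k ∣ toℕ y →
      ¬ (toℕ x + 2 ^ v) mod 2 ^ n ≡ y
    mixed y∈ dx ¬dy refl with below y∈ ¬dy | inLayerᵇ⁻ k _ (translate-mod dx)
    ... | i , _ , i<k , inL , _ | inj₁ (_ , inLk) = <-irrefl (InLayer-unique inL inLk) i<k
    ... | _ | inj₂ (refl , _) = contradiction k≤n 1+n≰n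
    ≈⇒≡ : ∀ {x y : Fin (2 ^ n)} → toℕ x ≈ toℕ y → x ≡ y
    ≈⇒≡ {x} {y} (%≡ eq) = Finₚ.toℕ-injective
      (trans (sym (m<n⇒m%n≡m (Finₚ.toℕ<n x))) (trans eq (m<n⇒m%n≡m (Finₚ.toℕ<n y))))
    f-injective : ∀ {x y} → x Subset.∈ LayerUnion n J → y Subset.∈ LayerUnion n J → f x ≡ f y → x ≡ y
    f-injective {x} {y} x∈ y∈ eq with 2 ^ k ∣? toℕ x | 2 ^ k ∣? toℕ y
    ... | no _ | no _ = eq
    ... | yes dx | no ¬dy = contradiction eq (mixed y∈ dx ¬dy)
    ... | no ¬dx | yes dy = contradiction (sym eq) (mixed x∈ dy ¬dx)
    ... | yes _ | yes _ = ≈⇒≡ (+-cancelˡ-≈ (2 ^ v) (≈-trans (≈-reflexive (+-comm (2 ^ v) (toℕ x)))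
      (≈-trans (%≡ (trans (sym (toℕ-mod _)) (trans (cong toℕ eq) (toℕ-mod _))))
        (≈-reflexive (+-comm (toℕ y) (2 ^ v))))))

  cubeFree⇒∣∣≤ : ∀ {d L} → IndexSet d L → d ≤ n → ∀ J → CubeFree n d (LayerUnion n J) →
    ∣ LayerUnion n J ∣ ≤ ∣ LayerUnion n L ∣
  cubeFree⇒∣∣≤ {d} {L} I d≤n J free with firstDifference J L (suc (suc n))
  ... | inj₁ agree = agree⇒∣∣≤ J L agree
  -- The first difference could be n + 1, where translation is impossible; membership in the index
  -- set gives k ≤ d ≤ n.
  ... | inj₂ (suc v , _ , _ , agree , inj₂ (k∈L , k∉J)) =
    first-missing⇒∣∣≤ J L v (≤-trans (proj₁ (IndexSet-bound I k∈L)) d≤n) agree k∈L k∉J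
  -- The exchange cube uses only layer `k` and layers of `L` before `k`; by agreement all of these
  -- belong to `J`.
  ... | inj₂ (k , 0<k , s≤s k≤ , agree , inj₁ (k∈J , k∉L)) with exchangeCube I k 0<k k∉L
  ... | S , refl , cube = contradiction free (cubeIn-LayerUnion J S λ σ → inJ (cube σ))
    where
    inJ : ∀ {s} → Exchanged L k s → ∃ λ i → i ∈ J × i ≤ suc n × InLayer i s
    inJ (i , inL , inj₁ (i∈ , i<k)) = i , proj₂ (agree (InLayer⇒1≤ inL) i<k) i∈ , ≤-trans (<⇒≤ i<k) k≤ , inL
    inJ (i , inL , inj₂ refl) = i , k∈J , k≤ , inL

theorem1p10 : (d n : ℕ) → 1 ≤ d → d ≤ n →
    CubeFree n d (𝒞 n d)
    × ((A : Subset (2 ^ n)) → (∃ λ (J : List ℕ) → A ≡ LayerUnion n J) →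
    CubeFree n d A → ∣ A ∣ ≤ ∣ 𝒞 n d ∣)
theorem1p10 d n 1≤d d≤n =
  Residues.LayerUnion-cubeFree n I d≤n , λ { _ (J , refl) free → cubeFree⇒∣∣≤ n I d≤n J free }
  where
  I : IndexSet d (indexSet d)
  I = indexSetFuel-IndexSet d d 1≤d ≤-refl
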